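{- Let $n\ge 1$ and $0\le k\le n-1$. There is a bijection between the set of permutations $\pi\in S_n$ with exactly $k$ descents and the set of maxmin trees of weight $0$ on the vertex set $\{1,\dots,n+1\}$ with exactly $k+1$ maxima.
   Context: A descent of $\pi\in S_n$ (written as the word $\pi(1)\cdots\pi(n)$) is an index $i$ with $\pi(i)>\pi(i+1)$. A maxmin tree on $\{1,\dots,N\}$ is a tree $T$ on that vertex set together with a surjective function $t\colon\{1,\dots,N\}\to\{1,2\}$ such that adjacent vertices $v,v'$ have $t(v)\neq t(v')$ and adjacent $v>v'$ have $t(v)>t(v')$; vertices with $t=2$ are maxima and those with $t=1$ minima. The weight $w(T)$ of a tree $T$ with integer vertex labels and such a tiering function $t$ is defined recursively: if $T$ has one vertex, $w(T)=0$. Otherwise let $v$ be the vertex with smallest label and $T_1,\dots,T_l$ the components after deleting $v$ (with restricted labels and tiering); let $u_i\in T_i$ be the neighbor of $v$ in $T_i$ and $w_i$ the number of $u\in T_i$ with $t(u)>t(v)$ and $u<u_i$. Then $w(T)=\sum_{i=1}^l (w_i+w(T_i))$. -}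

module Defs where

open import Data.Nat using (ℕ; zero; suc; _+_; _≤_)
open import Data.Bool using (Bool; true; false; _∧_; _∨_; not; if_then_else_; T)
open import Data.Fin using (Fin; zero; suc; inject₁; _<_; _<?_; _≟_)
open import Data.List using (allFin)
open import Data.Fin.Subset using (Subset; ⁅_⁆; ⊤)
open import Data.Vec using (Vec; tabulate; lookup)
open import Data.List using (List; []; _∷_; length; filter; map)
open import Data.Bool.ListAction using (any)
open import Data.Nat.ListAction using (sum)
open import Data.List.Relation.Unary.Unique.Propositional using (Unique)
open import Data.Maybe using (Maybe; just; nothing)
open import Data.Product using (Σ; _×_; _,_; ∃; proj₁)
open import Relation.Nullary using (¬_; does)
open import Relation.Binary.PropositionalEquality using (_≡_; _≢_)
open import Relation.Binary.Bundles using (Setoid)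
open import Relation.Binary.Structures using (IsEquivalence)
open import Data.Fin.Permutation using (Permutation′; _⟨$⟩ʳ_)
import Relation.Binary.PropositionalEquality as Eq

-- Permutations and descents.
-- π ∈ S_n is a permutation of Fin n; position i (0-based) corresponds to
-- position i+1 of the word π(1)⋯π(n); the value shift by 1 preserves order.

descents : ∀ {n} → Permutation′ n → ℕ
descents {zero}  π = 0
descents {suc m} π =
  length (filter (λ i → (π ⟨$⟩ʳ suc i) <? (π ⟨$⟩ʳ inject₁ i)) (allFin m))

PermsWithDescents : ℕ → ℕ → Setoid _ _
PermsWithDescents n k = record
  { Carrier = Σ (Permutation′ n) (λ π → descents π ≡ k)
  ; _≈_ = λ p q → ∀ i → (proj₁ p ⟨$⟩ʳ i) ≡ (proj₁ q ⟨$⟩ʳ i)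
  ; isEquivalence = record
      { refl = λ i → Eq.refl
      ; sym = λ e i → Eq.sym (e i)
      ; trans = λ e f i → Eq.trans (e i) (f i) }
  }

-- Graphs on the vertex set Fin N (vertex i stands for label i+1).

Graph : ℕ → Set
Graph N = Fin N → Fin N → Bool

data Walk {N} (G : Graph N) : Fin N → Fin N → Set where
  here : ∀ {u} → Walk G u u
  step : ∀ {u w v} → T (G u w) → Walk G w v → Walk G u v

Connected : ∀ {N} → Graph N → Set
Connected G = ∀ u v → Walk G u v

data Chain {N} (G : Graph N) : List (Fin N) → Set where
  nil  : Chain G []
  one  : ∀ {u} → Chain G (u ∷ [])
  cons : ∀ {u w vs} → T (G u w) → Chain G (w ∷ vs) → Chain G (u ∷ w ∷ vs)

Cycle : ∀ {N} → Graph N → Set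
Cycle {N} G = Σ (Fin N) λ v₀ → Σ (Fin N) λ v₁ → Σ (Fin N) λ v₂ → Σ (List (Fin N)) λ vs →
  Unique (v₀ ∷ v₁ ∷ v₂ ∷ vs) × Chain G (v₀ ∷ v₁ ∷ v₂ ∷ vs) × T (G (last v₂ vs) v₀)
  where
  last : Fin N → List (Fin N) → Fin N
  last x []       = x
  last x (y ∷ ys) = last y ys

Acyclic : ∀ {N} → Graph N → Set
Acyclic G = ¬ Cycle G

IsTree : ∀ {N} → Graph N → Set
IsTree G = (∀ u v → G u v ≡ G v u) × (∀ u → G u u ≡ false) × Connected G × Acyclic G

-- Tiering: true = tier 2 (maximum), false = tier 1 (minimum).

Tiering : ℕ → Set
Tiering N = Fin N → Bool

_tier>_ : Bool → Bool → Bool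
a tier> b = a ∧ not b

record IsMaxmin {N} (G : Graph N) (t : Tiering N) : Set where
  field
    tree       : IsTree G
    surjective : (∃ λ v → t v ≡ true) × (∃ λ v → t v ≡ false)
    alternate  : ∀ v v' → T (G v v') → t v ≢ t v'
    monotone   : ∀ v v' → T (G v v') → v' < v → T (t v tier> t v')

-- Weight (the recursive definition from the paper), computed on
-- induced subtrees given by vertex subsets.

module _ {N : ℕ} (G : Graph N) (t : Tiering N) where

  mem : Subset N → Fin N → Bool
  mem S x = lookup S x

  verts : Subset N → List (Fin N)
  verts S = filter (λ x → Data.Bool._≟_ (mem S x) true) (allFin N)

  remove : Subset N → Fin N → Subset N
  remove S v = tabulate λ x → mem S x ∧ not (does (x ≟ v))

  grow : Subset N → Subset N → Subset N
  grow S X = tabulate λ y → mem X y ∨ (mem S y ∧ any (λ x → mem X x ∧ G x y) (allFin N))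

  iter : ℕ → (Subset N → Subset N) → Subset N → Subset N
  iter zero    f X = X
  iter (suc j) f X = iter j f (f X)

  component : Subset N → Fin N → Subset N
  component S u = iter N (grow S) ⁅ u ⁆

  minVertex : Subset N → Maybe (Fin N)
  minVertex S with verts S
  ... | []    = nothing
  ... | x ∷ _ = just x

  count : (Fin N → Bool) → List (Fin N) → ℕ
  count p xs = length (filter (λ x → Data.Bool._≟_ (p x) true) xs)

  -- weight with fuel (fuel ≥ |S| suffices, as each recursive call is on a
  -- strictly smaller vertex set).  For a tree, the components T_i of
  -- T − v correspond bijectively to the neighbours u_i of v.
  weightF : ℕ → Subset N → ℕ
  weightF zero    S = 0
  weightF (suc f) S with minVertex S
  ... | nothing = 0
  ... | just v  =
    sum (map (λ u → let C = component S' u in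
                    count (λ x → (t x tier> t v) ∧ does (x <? u)) (verts C)
                    + weightF f C)
             (filter (λ u → Data.Bool._≟_ (mem S' u ∧ G v u) true) (allFin N)))
    where S' = remove S v

  weight : ℕ
  weight = weightF N ⊤

record MaxminTree (N : ℕ) : Set where
  field
    graph  : Graph N
    tier   : Tiering N
    maxmin : IsMaxmin graph tier

open MaxminTree

numMaxima : ∀ {N} → MaxminTree N → ℕ
numMaxima {N} T = length (filter (λ v → Data.Bool._≟_ (tier T v) true) (allFin N))

Weight0MaxminTrees : ℕ → ℕ → Setoid _ _
Weight0MaxminTrees N j = record
  { Carrier = Σ (MaxminTree N) (λ T → weight (graph T) (tier T) ≡ 0 × numMaxima T ≡ j)
  ; _≈_ = λ p q → (∀ u v → graph (proj₁ p) u v ≡ graph (proj₁ q) u v)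
                × (∀ v → tier (proj₁ p) v ≡ tier (proj₁ q) v)
  ; isEquivalence = record
      { refl = (λ u v → Eq.refl) , (λ v → Eq.refl)
      ; sym = λ { (e , f) → (λ u v → Eq.sym (e u v)) , (λ v → Eq.sym (f v)) }
      ; trans = λ { (e , f) (e' , f') → (λ u v → Eq.trans (e u v) (e' u v)) , (λ v → Eq.trans (f v) (f' v)) } }
  }

module Submission where

open import Defs
import Algebra.Properties.CommutativeMonoid.Sum as CommutativeMonoidSum
open import Data.Bool using (Bool; true; false; T; not; _∧_; _∨_)
import Data.Bool as Bool
open import Data.Bool.Properties using (T-∧; T-∨; T-≡)
import Data.Bool.Properties as Bool
open import Data.Empty using (⊥; ⊥-elim)
open import Data.Fin
  using (Fin; zero; suc; toℕ; fromℕ; fromℕ<; inject₁; punchOut; _<_; _≤_; _>_; _<?_; _≤?_; _≟_)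
import Data.Fin.Induction as Fin
open import Data.Fin.Permutation
  using (Permutation′; permutation; _⟨$⟩ʳ_; _⟨$⟩ˡ_; inverseˡ; inverseʳ; lift₀)
import Data.Fin.Properties as Fin
open import Data.Fin.Subset using (Subset; ⁅_⁆; ⊤; ∣_∣; _∈_)
import Data.Fin.Subset.Properties as Sub
open import Data.List using (List; []; _∷_; _++_; filter; map; allFin; length)
import Data.List as List
import Data.List.Membership.DecPropositional as DecMembership
import Data.List.Membership.Propositional as List
open import Data.List.Membership.Propositional using (find; lose)
import Data.List.Membership.Propositional.Properties as List
import Data.List.Properties as List
open import Data.List.Relation.Unary.All using (All; []; _∷_)
import Data.List.Relation.Unary.All as All
open import Data.List.Relation.Unary.AllPairs using (AllPairs; []; _∷_)
import Data.List.Relation.Unary.AllPairs.Properties as AllPairs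
open import Data.List.Relation.Unary.Any using (here; there)
import Data.List.Relation.Unary.Any.Properties as Any
open import Data.List.Relation.Unary.Unique.Propositional using (Unique)
open import Data.Maybe using (just; nothing)
open import Data.Nat using (ℕ; zero; suc; _+_; _∸_; z≤n; s≤s)
import Data.Nat as ℕ
open import Data.Nat.ListAction using (sum)
import Data.Nat.Properties as ℕ
open import Data.Product using (Σ; ∃; _×_; _,_; proj₁; proj₂)
open import Data.Sum using (_⊎_; inj₁; inj₂; [_,_]′)
open import Data.Unit using (tt)
open import Data.Vec using (lookup; tabulate)
import Data.Vec.Properties as Vec
open import Function using (_∘_; id; case_of_)
open import Function.Bundles using (Bijection; Equivalence; _⇔_; mk⇔)
open import Induction.WellFounded using (Acc; acc)
open import Relation.Binary.Construct.Closure.ReflexiveTransitive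
  using (Star; ε; _◅_; _◅◅_; reverse)
import Relation.Binary.Construct.Closure.ReflexiveTransitive as Star
open import Relation.Binary.Definitions using (tri<; tri≈; tri>)
open import Relation.Binary.PropositionalEquality
open import Relation.Nullary using (Dec; yes; no; ¬_; does; contradiction)
open import Relation.Nullary.Decidable using (_×-dec_; _⊎-dec_; _→-dec_; ¬?; does-⇔)
open Equivalence using () renaming (to to ⇒; from to ⇐)
module ∑ = CommutativeMonoidSum ℕ.+-0-commutativeMonoid

-- A maxmin tree of weight 0 is the same thing as an increasing tree on its vertices: let a be an
-- ancestor of x if some path from a to x has no label below a. Weight 0 says that each vertex v is
-- joined to the smallest maximum of each component above v that it is adjacent to, and the maxima
-- are the leaves of the increasing tree, so the graph is determined by the ancestor relation.
-- Increasing trees with root 0 in turn correspond to words 0 π(1) ⋯ π(n), where a is an ancestor of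
-- x if a precedes x and no label between them is smaller than a; a letter is a leaf exactly if it
-- is the last one or is followed by a smaller one. The word is recovered by sorting the labels
-- lexicographically by their sets of ancestors.

-- Preliminaries on Booleans and subsets, and components of induced subgraphs.

private variable
  N : ℕ
  A : Set

T-does : (a? : Dec A) → T (does a?) → A
T-does (yes a) _ = a

does-T : (a? : Dec A) → A → T (does a?)
does-T (yes _) _ = tt
does-T (no ¬a) a = ¬a a

T-ext : ∀ {a b} → (T a → T b) → (T b → T a) → a ≡ b
T-ext {false} {false} f g = refl
T-ext {false} {true}  f g = ⊥-elim (g tt)
T-ext {true}  {false} f g = ⊥-elim (f tt)
T-ext {true}  {true}  f g = refl

T-tabulate⁻ : ∀ (f : Fin N → Bool) x → T (lookup (tabulate f) x) → T (f x)
T-tabulate⁻ f x = subst T (Vec.lookup∘tabulate f x)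

T-tabulate⁺ : ∀ (f : Fin N → Bool) x → T (f x) → T (lookup (tabulate f) x)
T-tabulate⁺ f x = subst T (sym (Vec.lookup∘tabulate f x))

infix 4 _∋_
_∋_ : Subset N → Fin N → Set
S ∋ x = T (lookup S x)

∋⇒∈ : ∀ {S : Subset N} {x} → S ∋ x → x ∈ S
∋⇒∈ {S = S} {x} p = Vec.lookup⇒[]= x S (⇒ T-≡ p)

∈⇒∋ : ∀ {S : Subset N} {x} → x ∈ S → S ∋ x
∈⇒∋ p = ⇐ T-≡ (Vec.[]=⇒lookup p)

-- Both ends are recorded, so every vertex of a nonempty walk satisfies `P`. The empty walk says
-- nothing about `P`, so membership of the starting vertex is carried separately where it matters.
Within : Graph N → (Fin N → Set) → Fin N → Fin N → Set
Within G P u v = T (G u v) × P u × P v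

module _ (G : Graph N) (t : Tiering N) (S : Subset N) where

  private
    _⟶*_ = Star (Within G (S ∋_))

  grow⁻ : ∀ X y → grow G t S X ∋ y → X ∋ y ⊎ S ∋ y × ∃ λ x → X ∋ x × T (G x y)
  grow⁻ X y p with ⇒ T-∨ (T-tabulate⁻ _ y p)
  ... | inj₁ q = inj₁ q
  ... | inj₂ q with ⇒ T-∧ q
  ... | s , r with find (Any.any⁻ _ (allFin N) r)
  ... | x , _ , e = inj₂ (s , x , ⇒ T-∧ e)

  grow-⊇ : ∀ X y → X ∋ y → grow G t S X ∋ y
  grow-⊇ X y p = T-tabulate⁺ _ y (⇐ T-∨ (inj₁ p))

  grow-step : ∀ X {x y} → X ∋ x → S ∋ y → T (G x y) → grow G t S X ∋ y
  grow-step X {x} {y} p s e = T-tabulate⁺ _ y (⇐ T-∨ (inj₂ (⇐ T-∧ (s ,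
    Any.any⁺ _ (lose (List.∈-allFin x) (⇐ T-∧ (p , e)))))))

  iter-sound : ∀ u j X → (∀ x → X ∋ x → S ∋ x × (u ⟶* x)) →
               ∀ x → iter G t j (grow G t S) X ∋ x → S ∋ x × (u ⟶* x)
  iter-sound u zero    X h = h
  iter-sound u (suc j) X h = iter-sound u j (grow G t S X) λ y p → case grow⁻ X y p of λ where
    (inj₁ q) → h y q
    (inj₂ (s , x , q , e)) → let sx , w = h x q in s , w ◅◅ ((e , sx , s) ◅ ε)

  iter-⊇ : ∀ j X x → X ∋ x → iter G t j (grow G t S) X ∋ x
  iter-⊇ zero    X x p = p
  iter-⊇ (suc j) X x p = iter-⊇ j (grow G t S X) x (grow-⊇ X x p)

  Closed : Subset N → Set
  Closed X = ∀ y → grow G t S X ∋ y → X ∋ y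

  iter-closed′ : ∀ j X → Closed X → Closed (iter G t j (grow G t S) X)
  iter-closed′ zero    X c = c
  iter-closed′ (suc j) X c = iter-closed′ j (grow G t S X) λ y p →
    case grow⁻ (grow G t S X) y p of λ where
      (inj₁ q) → q
      (inj₂ (s , x , q , e)) → grow-step X (c x q) s e

  -- As long as X is not closed, growing it strictly increases its size, which is at most N.
  iter-closed : ∀ j X → N ℕ.< j + ∣ X ∣ → Closed (iter G t j (grow G t S) X)
  iter-closed zero    X h = contradiction (Sub.∣p∣≤n X) (ℕ.<⇒≱ h)
  iter-closed (suc j) X h with X Sub.⊂? grow G t S X
  ... | yes X⊂ = iter-closed j (grow G t S X) (ℕ.<-≤-trans h
        (subst (ℕ._≤ j + ∣ grow G t S X ∣) (ℕ.+-suc j ∣ X ∣)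
          (ℕ.+-monoʳ-≤ j (Sub.p⊂q⇒∣p∣<∣q∣ X⊂))))
  ... | no X⊄ = iter-closed′ (suc j) X λ y p → case Bool.T? (lookup X y) of λ where
        (yes q) → q
        (no ¬q) → contradiction
          ((λ {z} z∈ → ∋⇒∈ (grow-⊇ X z (∈⇒∋ z∈))) , y , ∋⇒∈ p , ¬q ∘ ∈⇒∋) X⊄

  component⇒walk : ∀ {u x} → S ∋ u → component G t S u ∋ x → S ∋ x × (u ⟶* x)
  component⇒walk {u} {x} s = iter-sound u N ⁅ u ⁆
    (λ y p → subst (λ z → S ∋ z × (u ⟶* z)) (sym (Sub.x∈⁅y⁆⇒x≡y u (∋⇒∈ p))) (s , ε)) x

  walk⇒component : ∀ {u x} → u ⟶* x → component G t S u ∋ x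
  walk⇒component {u} w = go w (iter-⊇ N ⁅ u ⁆ u (∈⇒∋ (Sub.x∈⁅x⁆ u)))
    where
    C = component G t S u
    -- The initial set is a singleton, so the size bound for `N` rounds reads `N < N + 1`.
    closed : Closed C
    closed = iter-closed N ⁅ u ⁆
      (subst (λ k → N ℕ.< N + k) (sym (Sub.∣⁅x⁆∣≡1 u)) (ℕ.≤-reflexive (sym (ℕ.+-comm N 1))))
    go : ∀ {y x} → y ⟶* x → C ∋ y → C ∋ x
    go ε p = p
    go ((e , _ , s) ◅ w) p = go w (closed _ (grow-step C p s e))

-- Weight zero as a local condition

Above : Graph N → ℕ → Fin N → Fin N → Set
Above G m = Within G (λ x → m ℕ.≤ toℕ x)

Above-mono : ∀ {G : Graph N} {m n} → m ℕ.≤ n → ∀ {x y} → Star (Above G n) x y → Star (Above G m) x y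
Above-mono m≤n = Star.map λ (e , p , q) → e , ℕ.≤-trans m≤n p , ℕ.≤-trans m≤n q

module _ {G : Graph N} where

  -- Transports an invariant along a walk; it is applied to vertex sets that no edge to a label
  -- above some threshold leaves.
  walk-within : ∀ {P Q : Fin N → Set} → (∀ {x y} → Q x → T (G x y) → P y → Q y) →
                ∀ {x y} → Q x → Star (Within G P) x y → Q y × Star (Within G Q) x y
  walk-within h q ε = q , ε
  walk-within h q ((e , _ , p) ◅ w) =
    let q′ = h q e p ; q″ , w′ = walk-within h q′ w in q″ , (e , q , q′) ◅ w′

  -- Cut the walk after its last visit to `m`: the rest starts at a neighbour of `m` and avoids `m`,
  -- hence stays in `Q`. The first alternative is a walk that never meets `m`.
  last-exit : ∀ {P Q : Fin N → Set} m → (∀ {x} → P x → x ≢ m → Q x) →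
              ∀ {x y} → P x → y ≢ m → Star (Within G P) x y →
              (x ≢ m × Q x × Star (Within G Q) x y) ⊎
              ∃ λ u → T (G m u) × Q u × Star (Within G Q) u y
  last-exit m h px y≢m ε = inj₁ (y≢m , h px y≢m , ε)
  last-exit m h {x} _ y≢m ((e , p , p′) ◅ w) with last-exit m h p′ y≢m w
  ... | inj₂ r = inj₂ r
  ... | inj₁ (_ , q′ , w′) with x ≟ m
  ... | yes refl = inj₂ (_ , e , q′ , w′)
  ... | no x≢m   = inj₁ (x≢m , h p x≢m , (e , h p x≢m , q′) ◅ w′)

  exit : ∀ {P Q : Fin N → Set} m → (∀ {x} → P x → x ≢ m → Q x) →
         ∀ {y} → P m → y ≢ m → Star (Within G P) m y →
         ∃ λ u → T (G m u) × Q u × Star (Within G Q) u y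
  exit m h pm y≢m w with last-exit m h pm y≢m w
  ... | inj₁ (m≢m , _) = contradiction refl m≢m
  ... | inj₂ r = r

-- For v < u adjacent, v and u are a minimum and a maximum, and the component of u in the graph
-- induced on the labels > v is the T_i of the recursion step that deletes v.
ZeroWeight : Graph N → Tiering N → Set
ZeroWeight G t = ∀ {v u x} → T (G v u) → v < u → Star (Above G (suc (toℕ v))) u x → T (t x) → u ≤ x

sum≡0⁻ : ∀ (f : A → ℕ) xs → sum (map f xs) ≡ 0 → ∀ {x} → x List.∈ xs → f x ≡ 0
sum≡0⁻ f (y ∷ xs) eq (here refl) = ℕ.m+n≡0⇒m≡0 (f y) eq
sum≡0⁻ f (y ∷ xs) eq (there p)   = sum≡0⁻ f xs (ℕ.m+n≡0⇒n≡0 (f y) eq) p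

sum≡0⁺ : ∀ (f : A → ℕ) xs → (∀ {x} → x List.∈ xs → f x ≡ 0) → sum (map f xs) ≡ 0
sum≡0⁺ f [] h = refl
sum≡0⁺ f (y ∷ xs) h = cong₂ _+_ (h (here refl)) (sum≡0⁺ f xs (h ∘ there))

module _ (G : Graph N) (t : Tiering N) where

  count≡0⁻ : ∀ p xs → count G t p xs ≡ 0 → ∀ {x} → x List.∈ xs → ¬ T (p x)
  count≡0⁻ p xs eq {x} x∈ px with filter (λ x → p x Bool.≟ true) xs
    | List.∈-filter⁺ (λ x → p x Bool.≟ true) x∈ (⇒ T-≡ px)
  ... | _ ∷ _ | _ with () ← eq

  count≡0⁺ : ∀ p xs → (∀ {x} → x List.∈ xs → ¬ T (p x)) → count G t p xs ≡ 0
  count≡0⁺ p [] h = refl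
  count≡0⁺ p (x ∷ xs) h with p x in eq
  ... | true  = contradiction (⇐ T-≡ eq) (h (here refl))
  ... | false = count≡0⁺ p xs (h ∘ there)

  verts⁺ : ∀ S {x} → S ∋ x → x List.∈ verts G t S
  verts⁺ S {x} p = List.∈-filter⁺ (λ x → lookup S x Bool.≟ true) (List.∈-allFin x) (⇒ T-≡ p)

  verts⁻ : ∀ S {x} → x List.∈ verts G t S → S ∋ x
  verts⁻ S p = ⇐ T-≡ (proj₂ (List.∈-filter⁻ (λ x → lookup S x Bool.≟ true) {xs = allFin N} p))

  minVertex-nothing : ∀ S → minVertex G t S ≡ nothing → ∀ {x} → ¬ (S ∋ x)
  minVertex-nothing S eq p with verts G t S | verts⁺ S p
  ... | _ ∷ _ | _ with () ← eq

  verts-sorted : ∀ S → AllPairs _<_ (verts G t S)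
  verts-sorted S = AllPairs.filter⁺ (λ x → lookup S x Bool.≟ true) (AllPairs.tabulate⁺-< id)

  -- `verts` inherits the increasing order of `allFin`, so its head is the least member.
  minVertex-just : ∀ S {m} → minVertex G t S ≡ just m → S ∋ m × (∀ {x} → S ∋ x → m ≤ x)
  minVertex-just S eq with verts G t S | (λ {x} → verts⁺ S {x}) | (λ {x} → verts⁻ S {x})
                         | verts-sorted S
  minVertex-just S refl | m ∷ xs | ⁺ | ⁻ | m< ∷ _ = ⁻ (here refl) , λ p → min (⁺ p)
    where
    min : ∀ {x} → x List.∈ m ∷ xs → m ≤ x
    min (here refl) = ℕ.≤-refl
    min (there q)   = ℕ.<⇒≤ (All.lookup m< q)

  remove⁻ : ∀ S v {x} → remove G t S v ∋ x → S ∋ x × x ≢ v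
  remove⁻ S v {x} p = let s , q = ⇒ T-∧ (T-tabulate⁻ _ x p) in
    s , λ x≡v → ¬T-not (does-T (x ≟ v) x≡v) q
    where
    ¬T-not : ∀ {b} → T b → ¬ T (not b)
    ¬T-not {true} _ ()

  remove⁺ : ∀ S v {x} → S ∋ x → x ≢ v → remove G t S v ∋ x
  remove⁺ S v {x} s x≢v = T-tabulate⁺ _ x (⇐ T-∧ (s , go (x ≟ v)))
    where
    go : (d : Dec (x ≡ v)) → T (not (does d))
    go (yes e) = x≢v e
    go (no _)  = tt

  low : (v u : Fin N) → Fin N → Bool
  low v u x = (t x tier> t v) ∧ does (x <? u)

  branch : ℕ → Subset N → Fin N → Fin N → ℕ
  branch f S v u = let C = component G t (remove G t S v) u in
    count G t (low v u) (verts G t C) + weightF G t f C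

  branches : Subset N → Fin N → List (Fin N)
  branches S v = filter (λ u → (lookup (remove G t S v) u ∧ G v u) Bool.≟ true) (allFin N)

  -- `weightF` is stuck on its `with` until the value of `minVertex` is known; this unfolds one
  -- round of the recursion.
  weightF-suc : ∀ f S {m} → minVertex G t S ≡ just m →
                weightF G t (suc f) S ≡ sum (map (branch f S m) (branches S m))
  weightF-suc f S eq with minVertex G t S
  weightF-suc f S refl | just m = refl

  branches⁺ : ∀ S v {u} → remove G t S v ∋ u → T (G v u) → u List.∈ branches S v
  branches⁺ S v {u} s e = List.∈-filter⁺ (λ u → (lookup (remove G t S v) u ∧ G v u) Bool.≟ true)
    (List.∈-allFin u) (⇒ T-≡ (⇐ T-∧ (s , e)))

  branches⁻ : ∀ S v {u} → u List.∈ branches S v → remove G t S v ∋ u × T (G v u)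
  branches⁻ S v p = ⇒ T-∧ (⇐ T-≡ (proj₂
    (List.∈-filter⁻ (λ u → (lookup (remove G t S v) u ∧ G v u) Bool.≟ true) {xs = allFin N} p)))

  remove-above : ∀ S {m} → (∀ {x} → S ∋ x → m ≤ x) → ∀ {x} → remove G t S m ∋ x → m < x
  remove-above S {m} m≤ p = let s , x≢m = remove⁻ S m p in Fin.≤∧≢⇒< (m≤ s) (x≢m ∘ sym)

  -- Holds for arbitrary `S`: after deletion of the minimum `m`, everything left lies above `m`, so
  -- walks inside a component are walks to which `ZeroWeight` applies.
  zeroWeight⇒weightF≡0 : ZeroWeight G t → ∀ f S → weightF G t f S ≡ 0
  zeroWeight⇒weightF≡0 zw zero    S = refl
  zeroWeight⇒weightF≡0 zw (suc f) S = go _ refl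
    where
    go : ∀ r → minVertex G t S ≡ r → weightF G t (suc f) S ≡ 0
    go nothing eq with minVertex G t S
    ... | nothing = refl
    ... | just _ with () ← eq
    go (just m) eq = trans (weightF-suc f S eq) (sum≡0⁺ (branch f S m) (branches S m) λ {u} u∈ →
      let u∈S′ , e = branches⁻ S m u∈
          above = remove-above S (proj₂ (minVertex-just S eq)) in
      cong₂ _+_
        (count≡0⁺ (low m u) (verts G t (component G t (remove G t S m) u)) λ x∈ q →
          let x∈C , w = component⇒walk G t (remove G t S m) u∈S′
                          (verts⁻ (component G t (remove G t S m) u) x∈)
              tx , x<u = ⇒ T-∧ q in
          ℕ.<⇒≱ (T-does (_ <? u) x<u)
            (zw e (above u∈S′) (Star.map (λ (e , p , q) → e , above p , above q) w)
              (proj₁ (⇒ T-∧ tx))))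
        (zeroWeight⇒weightF≡0 zw f (component G t (remove G t S m) u)))

  module _ (symG : ∀ {x y} → T (G x y) → T (G y x))
           (mono : ∀ {v u} → T (G v u) → v < u → T (t u) × T (not (t v))) where

    -- Follows the recursion into the component containing `v`, until `v` itself is the vertex
    -- deleted. The first hypothesis keeps the fuel sufficient, since each deletion raises the least
    -- label; the next three make `S` a component of the graph on the labels at least `a`.
    weightF≡0⇒zeroWeight : ∀ f S a →
      (∀ {x} → S ∋ x → N ℕ.≤ toℕ x + f) →
      (∀ {x} → S ∋ x → a ℕ.≤ toℕ x) →
      (∀ {x y} → S ∋ x → T (G x y) → a ℕ.≤ toℕ y → S ∋ y) →
      (∀ {x y} → S ∋ x → S ∋ y → Star (Above G a) x y) →
      weightF G t f S ≡ 0 →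
      ∀ {v u x} → S ∋ v → T (G v u) → v < u → Star (Above G (suc (toℕ v))) u x → T (t x) → u ≤ x
    weightF≡0⇒zeroWeight zero S a fuel _ _ _ _ {v} v∈ = 
      contradiction (subst (N ℕ.≤_) (ℕ.+-identityʳ (toℕ v)) (fuel v∈)) (ℕ.<⇒≱ (Fin.toℕ<n v))
    weightF≡0⇒zeroWeight (suc f) S a fuel above closed conn w≡0 {v} {u} {x} v∈ e v<u w tx = go _ refl
      where
      go : ∀ r → minVertex G t S ≡ r → u ≤ x
      go nothing eq = ⊥-elim (minVertex-nothing S eq v∈)
      go (just m) eq with minVertex-just S eq
      ... | m∈ , m≤ = cases (v ≟ m)
        where
        S′ = remove G t S m
        above′ = remove-above S m≤

        branch≡0 : ∀ {u} → S′ ∋ u → T (G m u) → branch f S m u ≡ 0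
        branch≡0 s e = sum≡0⁻ (branch f S m) (branches S m)
          (trans (sym (weightF-suc f S eq)) w≡0) (branches⁺ S m s e)

        closed′ : ∀ {x y} → S′ ∋ x → T (G x y) → m < y → S′ ∋ y
        closed′ {y = y} s e m<y = remove⁺ S m
          (closed (proj₁ (remove⁻ S m s)) e (ℕ.≤-trans (above m∈) (ℕ.<⇒≤ m<y)))
          (Fin.<⇒≢ m<y ∘ sym)

        cases : Dec (v ≡ m) → u ≤ x
        -- Some `x < u` in the component of `u` would be counted in the summand of `u`, which
        -- vanishes.
        cases (yes refl) = ℕ.≮⇒≥ λ x<u →
          count≡0⁻ (low m u) (verts G t (component G t S′ u)) (ℕ.m+n≡0⇒m≡0 _ (branch≡0 u∈ e))
            (verts⁺ (component G t S′ u) (walk⇒component G t S′ (proj₂ (walk-within closed′ u∈ w))))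
            (⇐ T-∧ (⇐ T-∧ (tx , proj₂ (mono e v<u)) , does-T (x <? u) x<u))
          where u∈ = remove⁺ S m (closed m∈ e (ℕ.≤-trans (above m∈) (ℕ.<⇒≤ v<u)))
                           (Fin.<⇒≢ v<u ∘ sym)
        -- Otherwise `v` lies in the component of some neighbour `r` of `m`, found by cutting a walk
        -- from `m` to `v` after its last visit to `m`.
        cases (no v≢m) with exit {G = G} {P = S ∋_} {Q = S′ ∋_} m (remove⁺ S m) m∈ v≢m
                              (proj₂ (walk-within closed m∈ (conn m∈ v∈)))
        ... | r , m~r , r∈ , r⟶v = weightF≡0⇒zeroWeight f C (suc (toℕ m))
            (λ {y} y∈ → ℕ.≤-trans (fuel m∈) (ℕ.≤-trans (ℕ.≤-reflexive (ℕ.+-suc (toℕ m) f))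
              (ℕ.+-monoˡ-≤ f (above′ (C⇒S′ y∈)))))
            (above′ ∘ C⇒S′)
            (λ y∈ e m<z → let s , p = reach y∈ in
              walk⇒component G t S′ (p ◅◅ (e , s , closed′ s e m<z) ◅ ε))
            (λ y∈ z∈ → up (reverse (λ (e , p , q) → symG e , q , p) (proj₂ (reach y∈))
                           ◅◅ proj₂ (reach z∈)))
            (ℕ.m+n≡0⇒n≡0 (count G t (low m r) (verts G t C)) (branch≡0 r∈ m~r))
            (walk⇒component G t S′ r⟶v) e v<u w tx
          where
          C = component G t S′ r
          reach : ∀ {y} → C ∋ y → S′ ∋ y × Star (Within G (S′ ∋_)) r y
          reach = component⇒walk G t S′ r∈
          C⇒S′ : ∀ {y} → C ∋ y → S′ ∋ y
          C⇒S′ = proj₁ ∘ reach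
          up : ∀ {y z} → Star (Within G (S′ ∋_)) y z → Star (Above G (suc (toℕ m))) y z
          up = Star.map λ (e , p , q) → e , above′ p , above′ q

    weight≡0⇒zeroWeight : (∀ x y → Star (Above G 0) x y) → weight G t ≡ 0 → ZeroWeight G t
    weight≡0⇒zeroWeight conn w≡0 = weightF≡0⇒zeroWeight N ⊤ 0
      (λ {x} _ → ℕ.m≤n+m N (toℕ x)) (λ _ → z≤n) (λ _ _ _ → ∋⊤) (λ _ _ → conn _ _) w≡0 ∋⊤
      where
      ∋⊤ : ∀ {x} → ⊤ {N} ∋ x
      ∋⊤ = ∈⇒∋ {S = ⊤ {N}} Sub.∈⊤

-- Increasing trees and maxmin trees of weight zero

Least : (Fin N → Set) → Fin N → Set
Least P x = P x × (∀ y → P y → x ≤ y)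

least : ∀ {P : Fin N → Set} → (∀ x → Dec (P x)) → ∀ {x} → P x → ∃ (Least P)
least {N = suc N} P? {x} p with P? zero | x
... | yes p₀ | _     = zero , p₀ , λ _ _ → z≤n
... | no ¬p₀ | zero  = contradiction p ¬p₀
... | no ¬p₀ | suc x = let y , py , y≤ = least (P? ∘ suc) p in
  suc y , py , λ where
    zero    p₀ → contradiction p₀ ¬p₀
    (suc z) pz → s≤s (y≤ z pz)

-- An increasing tree with root zero, given by its ancestor relation.
record TreeOrder (n : ℕ) : Set₁ where
  infix 4 _⊑_ _⊑?_
  field
    _⊑_     : Fin (suc n) → Fin (suc n) → Set
    _⊑?_    : ∀ x y → Dec (x ⊑ y)
    ⊑-refl  : ∀ {x} → x ⊑ x
    ⊑⇒≤     : ∀ {x y} → x ⊑ y → x ≤ y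
    ⊑-trans : ∀ {x y z} → x ⊑ y → y ⊑ z → x ⊑ z
    ⊑-chain : ∀ {x y z} → x ⊑ z → y ⊑ z → x ≤ y → x ⊑ y
    ⊑-root  : ∀ {x} → zero ⊑ x

  -- By `⊑⇒≤`, this excludes proper descendants.
  Leaf : Fin (suc n) → Set
  Leaf x = ∀ y → x ⊑ y → y ≤ x

  leaf? : ∀ x → Dec (Leaf x)
  leaf? x = Fin.all? λ y → (x ⊑? y) →-dec (y ≤? x)

  -- x and y lie in the same component of the forest induced on the labels ≥ m.
  Joined : ℕ → Fin (suc n) → Fin (suc n) → Set
  Joined m x y = ∃ λ b → m ℕ.≤ toℕ b × b ⊑ x × b ⊑ y

  joined? : ∀ m x y → Dec (Joined m x y)
  joined? m x y = Fin.any? λ b → (m ℕ.≤? toℕ b) ×-dec (b ⊑? x) ×-dec (b ⊑? y)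

  joined-sym : ∀ {m x y} → Joined m x y → Joined m y x
  joined-sym (b , m≤b , p , q) = b , m≤b , q , p

  -- Both witnesses are ancestors of `y`, hence comparable, and the smaller one is an ancestor of
  -- all three vertices.
  joined-trans : ∀ {m x y z} → Joined m x y → Joined m y z → Joined m x z
  joined-trans (b , m≤b , bx , by) (c , m≤c , cy , cz) with Fin.≤-total b c
  ... | inj₁ b≤c = b , m≤b , bx , ⊑-trans (⊑-chain by cy b≤c) cz
  ... | inj₂ c≤b = c , m≤c , ⊑-trans (⊑-chain cy by c≤b) bx , cz

  walk⇒joined : ∀ {G : Graph (suc n)} → (∀ {x y} → T (G x y) → x ⊑ y ⊎ y ⊑ x) →
                ∀ {m x y} → m ℕ.≤ toℕ x → Star (Above G m) x y → Joined m x y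
  walk⇒joined h m≤x ε = _ , m≤x , ⊑-refl , ⊑-refl
  walk⇒joined h m≤x ((e , _ , m≤y) ◅ w) = joined-trans
    ([ (λ x⊑y → _ , m≤x , ⊑-refl , x⊑y) , (λ y⊑x → _ , m≤y , y⊑x , ⊑-refl) ]′ (h e))
    (walk⇒joined h m≤y w)

  leaf-above : ∀ x → ∃ λ y → x ⊑ y × Leaf y
  leaf-above x = go x (Fin.>-wellFounded x)
    where
    go : ∀ x → Acc _>_ x → ∃ λ y → x ⊑ y × Leaf y
    go x (acc rec) with leaf? x
    ... | yes l = x , ⊑-refl , l
    ... | no ¬l with Fin.¬∀⟶∃¬ _ _ (λ y → (x ⊑? y) →-dec (y ≤? x)) ¬l
    ... | y , ¬h with x ⊑? y | y ≤? x
    ... | no x⋢y  | _ = contradiction (λ x⊑y → contradiction x⊑y x⋢y) ¬h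
    ... | yes _   | yes y≤x = contradiction (λ _ → y≤x) ¬h
    ... | yes x⊑y | no y≰x = let z , y⊑z , l = go y (rec (ℕ.≰⇒> y≰x)) in z , ⊑-trans x⊑y y⊑z , l

  -- The parent v of a vertex c of the increasing tree is joined to the smallest leaf above c.
  Edge : Fin (suc n) → Fin (suc n) → Set
  Edge v u = v < u × v ⊑ u × Leaf u × (∀ y → Leaf y → Joined (suc (toℕ v)) u y → u ≤ y)

  edge? : ∀ v u → Dec (Edge v u)
  edge? v u = (v <? u) ×-dec (v ⊑? u) ×-dec leaf? u ×-dec
    Fin.all? λ y → leaf? y →-dec (joined? (suc (toℕ v)) u y →-dec (u ≤? y))

  treeGraph : Graph (suc n)
  treeGraph u v = does (edge? u v) ∨ does (edge? v u)

  leafTier : Tiering (suc n)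
  leafTier x = does (leaf? x)

infix 4 _≅_
_≅_ : ∀ {n} → TreeOrder n → TreeOrder n → Set
O ≅ O′ = ∀ {x y} → TreeOrder._⊑_ O x y ⇔ TreeOrder._⊑_ O′ x y

T-not : ∀ {b} → T (not b) → ¬ T b
T-not {true} ()

¬T⇒T-not : ∀ {b} → ¬ T b → T (not b)
¬T⇒T-not {false} _ = tt
¬T⇒T-not {true}  h = h tt

-- The working form of a maxmin tree of weight `0`, with local conditions only besides
-- connectedness. Acyclicity is a consequence of `zeroWeight`, see `acyclic`.
record IsZeroMaxmin {N} (G : Graph N) (t : Tiering N) : Set where
  field
    symmetric   : ∀ {x y} → T (G x y) → T (G y x)
    irreflexive : ∀ {x} → ¬ T (G x x)
    increasing  : ∀ {v u} → T (G v u) → v < u → T (t u) × T (not (t v))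
    inner       : ∀ {v} → T (not (t v)) → ∃ λ u → v < u × T (G v u)
    connected   : ∀ x y → Star (Above G 0) x y
    zeroWeight  : ZeroWeight G t

  reverse-walk : ∀ {m x y} → Star (Above G m) x y → Star (Above G m) y x
  reverse-walk = reverse λ (e , p , q) → symmetric e , q , p

  _⟶_ : Fin N → Fin N → Set
  a ⟶ x = Star (Above G (toℕ a)) a x

  ⟶⇒≤ : ∀ {a x} → a ⟶ x → a ≤ x
  ⟶⇒≤ w = go w ℕ.≤-refl
    where
    go : ∀ {m x y} → Star (Above G m) x y → m ℕ.≤ toℕ x → m ℕ.≤ toℕ y
    go ε p = p
    go ((_ , _ , q) ◅ w) _ = go w q

  -- Both `p` and `q` are maxima of one component above `m`, and `zeroWeight` bounds each by the
  -- other.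
  neighbour-unique : ∀ {m p q} → T (G m p) → T (G m q) → m < p → m < q →
                     Star (Above G (suc (toℕ m))) p q → p ≡ q
  neighbour-unique mp mq m<p m<q w = Fin.≤-antisym
    (zeroWeight mp m<p w (proj₁ (increasing mq m<q)))
    (zeroWeight mq m<q (reverse-walk w) (proj₁ (increasing mp m<p)))

module _ {n} {G : Graph (suc n)} {t : Tiering (suc n)} (Z : IsZeroMaxmin G t)
         (O : TreeOrder n) where
  open IsZeroMaxmin Z
  open TreeOrder O

  module _ (spec : ∀ {x y} → x ⊑ y ⇔ (x ⟶ y)) where

    private
      adjacent⇒⊑ : ∀ {x y} → T (G x y) → x < y → x ⊑ y
      adjacent⇒⊑ e x<y = ⇐ spec ((e , ℕ.≤-refl , ℕ.<⇒≤ x<y) ◅ ε)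

      comparable : ∀ {x y} → T (G x y) → x ⊑ y ⊎ y ⊑ x
      comparable {x} {y} e with ℕ.<-cmp (toℕ x) (toℕ y)
      ... | tri< x<y _ _ = inj₁ (adjacent⇒⊑ e x<y)
      ... | tri≈ _ x≡y _ = inj₁ (subst (x ⊑_) (Fin.toℕ-injective x≡y) ⊑-refl)
      ... | tri> _ _ y<x = inj₂ (adjacent⇒⊑ (symmetric e) y<x)

      joined⇒walk : ∀ {m x y} → Joined m x y → Star (Above G m) x y
      joined⇒walk (b , m≤b , bx , by) =
        Above-mono m≤b (reverse-walk (⇒ spec bx) ◅◅ ⇒ spec by)

      leaf⇒tier : ∀ {x} → Leaf x → T (t x)
      leaf⇒tier {x} l with Bool.T? (t x)
      ... | yes tx = tx
      ... | no ¬tx = let u , x<u , e = inner (¬T⇒T-not ¬tx) in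
        contradiction (l u (adjacent⇒⊑ e x<u)) (ℕ.<⇒≱ x<u)

      -- A walk to a proper descendant starts with an edge to a larger label, which makes `x` a
      -- minimum.
      tier⇒leaf : ∀ {x} → T (t x) → Leaf x
      tier⇒leaf {x} tx y x⊑y with ⇒ spec x⊑y
      ... | ε = ℕ.≤-refl
      ... | (e , _ , x≤z) ◅ _ = contradiction tx
        (T-not (proj₂ (increasing e (Fin.≤∧≢⇒< x≤z λ { refl → irreflexive e }))))

      adjacent⇒edge : ∀ {v u} → T (G v u) → v < u → Edge v u
      adjacent⇒edge e v<u = v<u , adjacent⇒⊑ e v<u , tier⇒leaf (proj₁ (increasing e v<u)) ,
        λ y ly j → zeroWeight e v<u (joined⇒walk j) (leaf⇒tier ly)

      -- The walk from `v` to `u` leaves `v` through a neighbour `u′` in the component of `u` above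
      -- `v`. Then `u′ ≤ u` by `zeroWeight` and `u ≤ u′` by the minimality in `Edge`.
      edge⇒adjacent : ∀ {v u} → Edge v u → T (G v u)
      edge⇒adjacent {v} {u} (v<u , v⊑u , lu , u≤)
        with exit {G = G} v (λ v≤x x≢v → Fin.≤∧≢⇒< v≤x (x≢v ∘ sym))
               ℕ.≤-refl (Fin.<⇒≢ v<u ∘ sym) (⇒ spec v⊑u)
      ... | u′ , e , v<u′ , w = subst (T ∘ G v) (Fin.≤-antisym
        (zeroWeight e v<u′ w (leaf⇒tier lu))
        (u≤ u′ (tier⇒leaf (proj₁ (increasing e v<u′)))
          (joined-sym (walk⇒joined comparable v<u′ w)))) e

    -- `O` is only required to agree with walks up to `⇔`. This serves both to recover a given tree
    -- from a word and to compare the trees of two equivalent orders.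
    treeGraph≗ : ∀ u v → treeGraph u v ≡ G u v
    treeGraph≗ u v = T-ext
      (λ p → case ⇒ T-∨ p of λ where
        (inj₁ q) → edge⇒adjacent (T-does (edge? u v) q)
        (inj₂ q) → symmetric (edge⇒adjacent (T-does (edge? v u) q)))
      (λ e → ⇐ T-∨ (case ℕ.<-cmp (toℕ u) (toℕ v) of λ where
        (tri< u<v _ _) → inj₁ (does-T (edge? u v) (adjacent⇒edge e u<v))
        (tri≈ _ u≡v _) → contradiction (subst (T ∘ G u) (sym (Fin.toℕ-injective u≡v)) e) irreflexive
        (tri> _ _ v<u) → inj₂ (does-T (edge? v u) (adjacent⇒edge (symmetric e) v<u))))

    leafTier≗ : ∀ x → leafTier x ≡ t x
    leafTier≗ x = T-ext (leaf⇒tier ∘ T-does (leaf? x)) (does-T (leaf? x) ∘ tier⇒leaf)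

module _ {n} {G : Graph (suc n)} {t : Tiering (suc n)} (Z : IsZeroMaxmin G t) where
  open IsZeroMaxmin Z

  private
    from : Fin (suc n) → Subset (suc n)
    from a = tabulate λ x → does (a ≤? x)

    from⁻ : ∀ {a x} → from a ∋ x → a ≤ x
    from⁻ {a} {x} p = T-does (a ≤? x) (T-tabulate⁻ (λ x → does (a ≤? x)) x p)

    from⁺ : ∀ {a x} → a ≤ x → from a ∋ x
    from⁺ {a} {x} p = T-tabulate⁺ (λ x → does (a ≤? x)) x (does-T (a ≤? x) p)

    -- The `component` used for the weight doubles as a decision procedure for reachability among
    -- the labels at least `a`.
    _⟶?_ : ∀ a x → Dec (a ⟶ x)
    a ⟶? x with Bool.T? (lookup (component G t (from a) a) x)
    ... | yes p = yes (Star.map (λ (e , p , q) → e , from⁻ p , from⁻ q)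
                        (proj₂ (component⇒walk G t (from a) (from⁺ {a} ℕ.≤-refl) p)))
    ... | no ¬p = no λ w → ¬p (walk⇒component G t (from a)
                        (Star.map (λ (e , p , q) → e , from⁺ {a} p , from⁺ {a} q) w))

  walkOrder : TreeOrder n
  walkOrder = record
    { _⊑_     = _⟶_
    ; _⊑?_    = _⟶?_
    ; ⊑-refl  = ε
    ; ⊑⇒≤     = ⟶⇒≤
    ; ⊑-trans = λ v w → v ◅◅ Above-mono (⟶⇒≤ v) w
    ; ⊑-chain = λ v w x≤y → v ◅◅ Above-mono x≤y (reverse-walk w)
    ; ⊑-root  = connected zero _
    }

module _ {n} (O : TreeOrder n) where
  open TreeOrder O

  private
    G = treeGraph

    edge⇒adjacent : ∀ {v u} → Edge v u → T (G v u)
    edge⇒adjacent {v} {u} = ⇐ (T-∨ {does (edge? v u)}) ∘ inj₁ ∘ does-T (edge? v u)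

    symmetric : ∀ x y → T (G x y) → T (G y x)
    symmetric x y = subst T (Bool.∨-comm (does (edge? x y)) (does (edge? y x)))

    adjacent⇒edge : ∀ {v u} → T (G v u) → Edge v u ⊎ Edge u v
    adjacent⇒edge {v} {u} p with ⇒ (T-∨ {does (edge? v u)}) p
    ... | inj₁ q = inj₁ (T-does (edge? v u) q)
    ... | inj₂ q = inj₂ (T-does (edge? u v) q)

    adjacent⇒edge< : ∀ {v u} → T (G v u) → v < u → Edge v u
    adjacent⇒edge< {v} {u} p v<u with adjacent⇒edge {v} {u} p
    ... | inj₁ e = e
    ... | inj₂ (u<v , _) = contradiction v<u (ℕ.<-asym u<v)

    comparable : ∀ {x y} → T (G x y) → x ⊑ y ⊎ y ⊑ x
    comparable {x} {y} p with adjacent⇒edge {x} {y} p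
    ... | inj₁ (_ , x⊑y , _) = inj₁ x⊑y
    ... | inj₂ (_ , y⊑x , _) = inj₂ y⊑x

    -- By induction from large labels down. The smallest leaf `u` in the component of `y` above `x`
    -- is adjacent to `x`, and `u` and `y` have a common ancestor `b > x`; the walk goes from `x` to
    -- `u`, down to `b` and up to `y`.
    ⊑⇒walk : ∀ x {y} → Acc _>_ x → x ⊑ y → Star (Above G (toℕ x)) x y
    ⊑⇒walk x {y} (acc rec) x⊑y with x ≟ y
    ... | yes refl = ε
    ... | no x≢y with leaf-above y
    ... | z , y⊑z , lz
      with least (λ u → leaf? u ×-dec joined? (suc (toℕ x)) u y)
             (lz , y , Fin.≤∧≢⇒< (⊑⇒≤ x⊑y) x≢y , y⊑z , ⊑-refl)
    ... | u , (lu , b , x<b , b⊑u , b⊑y) , u≤ =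
      (edge⇒adjacent (x<u , ⊑-trans x⊑b b⊑u , lu ,
        λ v lv j → u≤ v (lv , joined-trans (joined-sym j) (b , x<b , b⊑u , b⊑y))) ,
        ℕ.≤-refl , ℕ.<⇒≤ x<u)
      ◅ Above-mono (ℕ.<⇒≤ x<b)
          (reverse (λ {x} {y} (e , p , q) → symmetric x y e , q , p) (⊑⇒walk b (rec x<b) b⊑u)
           ◅◅ ⊑⇒walk b (rec x<b) b⊑y)
      where
      x⊑b = ⊑-chain x⊑y b⊑y (ℕ.<⇒≤ x<b)
      x<u = ℕ.<-≤-trans x<b (⊑⇒≤ b⊑u)

  -- Makes the ancestor relation readable from the graph. Backwards, a walk gives a common ancestor
  -- `b` of `x` and `y` with `x ≤ b`, and `b ⊑ x` forces `b` to be `x`.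
  treeGraph-spec : ∀ {x y} → x ⊑ y ⇔ Star (Above G (toℕ x)) x y
  treeGraph-spec {x} {y} = mk⇔ (⊑⇒walk x (Fin.>-wellFounded x)) λ w →
    let b , x≤b , b⊑x , b⊑y = walk⇒joined {G = G} (λ {x} {y} → comparable {x} {y}) ℕ.≤-refl w in
    subst (_⊑ y) (Fin.≤-antisym (⊑⇒≤ b⊑x) x≤b) b⊑y

  treeGraph-zeroMaxmin : IsZeroMaxmin G leafTier
  treeGraph-zeroMaxmin = record
    { symmetric   = λ {x} {y} → symmetric x y
    ; irreflexive = λ {x} p →
        let x≮x = ℕ.<-irrefl refl ∘ proj₁ in [ x≮x , x≮x ]′ (adjacent⇒edge {x} {x} p)
    ; increasing  = λ {v} {u} p v<u → let _ , v⊑u , lu , _ = adjacent⇒edge< {v} {u} p v<u in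
        does-T (leaf? u) lu ,
        ¬T⇒T-not (λ lv → ℕ.<⇒≱ v<u (T-does (leaf? v) lv u v⊑u))
    ; inner       = inner
    ; connected   = λ x y →
        reverse (λ {x} {y} (e , p , q) → symmetric x y e , q , p) (⇒ treeGraph-spec ⊑-root)
        ◅◅ ⇒ treeGraph-spec ⊑-root
    ; zeroWeight  = λ {v} {u} {x} p v<u w tx → let _ , _ , _ , u≤ = adjacent⇒edge< {v} {u} p v<u in
        u≤ x (T-does (leaf? x) tx) (walk⇒joined {G = G} (λ {x} {y} → comparable {x} {y}) v<u w)
    }
    where
    inner : ∀ {v} → T (not (leafTier v)) → ∃ λ u → v < u × T (G v u)
    inner {v} nl with leaf-above v
    ... | y , v⊑y , ly with ⇒ treeGraph-spec v⊑y
    ... | ε = contradiction (does-T (leaf? v) ly) (T-not nl)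
    ... | _◅_ {j = z} (e , _ , v≤z) _ with adjacent⇒edge {v} {z} e
    ... | inj₁ (v<z , _) = _ , v<z , e
    ... | inj₂ (z<v , _) = contradiction v≤z (ℕ.<⇒≱ z<v)

-- Cycles, and the passage between `IsMaxmin` and `IsZeroMaxmin`.

end : A → List A → A
end x []       = x
end x (y ∷ ys) = end y ys

end-snoc : ∀ (x : A) ys {y} → end x (ys ++ y ∷ []) ≡ y
end-snoc x []       = refl
end-snoc x (z ∷ ys) = end-snoc z ys

end-∈ : ∀ (x : A) ys → end x ys List.∈ x ∷ ys
end-∈ x []       = here refl
end-∈ x (y ∷ ys) = there (end-∈ y ys)

end-unique : ∀ (f : A → List A → A) → (∀ x → f x [] ≡ x) →
             (∀ x y ys → f x (y ∷ ys) ≡ f y ys) → ∀ x xs → f x xs ≡ end x xs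
end-unique f f[] f∷ x []       = f[] x
end-unique f f[] f∷ x (y ∷ ys) = trans (f∷ x y ys) (end-unique f f[] f∷ y ys)

module _ {G : Graph N} where

  walk⇒star : ∀ {u v} → Walk G u v → Star (Above G 0) u v
  walk⇒star here       = ε
  walk⇒star (step e w) = (e , z≤n , z≤n) ◅ walk⇒star w

  star⇒walk : ∀ {u v} → Star (Above G 0) u v → Walk G u v
  star⇒walk ε             = here
  star⇒walk ((e , _) ◅ w) = step e (star⇒walk w)

  Cyclic : List (Fin N) → Set
  Cyclic []       = ⊥
  Cyclic (x ∷ xs) = Unique (x ∷ xs) × Chain G (x ∷ xs) × T (G (end x xs) x)

  chain-snoc : ∀ {x y} xs → Chain G (x ∷ xs) → T (G (end x xs) y) → Chain G (x ∷ xs ++ y ∷ [])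
  chain-snoc []       one        e = cons e one
  chain-snoc (_ ∷ xs) (cons d c) e = cons d (chain-snoc xs c e)

  cyclic-rotate₁ : ∀ x xs → Cyclic (x ∷ xs) → Cyclic (xs ++ x ∷ [])
  cyclic-rotate₁ x []       c = c
  cyclic-rotate₁ x (y ∷ ys) (x∉ ∷ uniq , cons d c , e) =
    AllPairs.++⁺ uniq ([] ∷ []) (All.map (λ x≢z → (x≢z ∘ sym) ∷ []) x∉) ,
    chain-snoc ys c e ,
    subst (λ z → T (G z y)) (sym (end-snoc y ys)) d

  cyclic-rotate : ∀ xs {y} ys → Cyclic (xs ++ y ∷ ys) → Cyclic (y ∷ ys ++ xs)
  cyclic-rotate []       {y} ys c = subst (Cyclic ∘ (y ∷_)) (sym (List.++-identityʳ ys)) c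
  cyclic-rotate (x ∷ xs) {y} ys c = subst (Cyclic ∘ (y ∷_)) (List.++-assoc ys (x ∷ []) xs)
    (cyclic-rotate xs (ys ++ x ∷ [])
      (subst Cyclic (List.++-assoc xs (y ∷ ys) (x ∷ [])) (cyclic-rotate₁ x (xs ++ y ∷ ys) c)))

  chain⇒walk : ∀ {m} x xs → All (λ y → m ℕ.≤ toℕ y) (x ∷ xs) → Chain G (x ∷ xs) →
               Star (Above G m) x (end x xs)
  chain⇒walk x []       _              _          = ε
  chain⇒walk x (y ∷ xs) (px ∷ py ∷ ps) (cons e c) = (e , px , py) ◅ chain⇒walk y xs (py ∷ ps) c

  -- In Cycle the last vertex is computed by a local function that cannot be named here, hence
  -- the abstraction over f.
  cycle⇒cyclic′ : ∀ (f : Fin N → List (Fin N) → Fin N) → (∀ x → f x [] ≡ x) →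
    (∀ x y ys → f x (y ∷ ys) ≡ f y ys) →
    (Σ (Fin N) λ v₀ → Σ (Fin N) λ v₁ → Σ (Fin N) λ v₂ → Σ (List (Fin N)) λ vs →
      Unique (v₀ ∷ v₁ ∷ v₂ ∷ vs) × Chain G (v₀ ∷ v₁ ∷ v₂ ∷ vs) × T (G (f v₂ vs) v₀)) →
    ∃ λ l → 3 ℕ.≤ length l × Cyclic l
  cycle⇒cyclic′ f f[] f∷ (v₀ , v₁ , v₂ , vs , uniq , chain , e) =
    v₀ ∷ v₁ ∷ v₂ ∷ vs , s≤s (s≤s (s≤s z≤n)) ,
    uniq , chain , subst (λ z → T (G z v₀)) (end-unique f f[] f∷ v₂ vs) e

  cycle⇒cyclic : Cycle G → ∃ λ l → 3 ℕ.≤ length l × Cyclic l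
  cycle⇒cyclic = cycle⇒cyclic′ _ (λ _ → refl) (λ _ _ _ → refl)

  least-first : ∀ l → Cyclic l → ∃ λ m → ∃ λ r →
                length l ≡ suc (length r) × All (m <_) r × Cyclic (m ∷ r)
  least-first l@(x ∷ xs) c with least (λ y → DecMembership._∈?_ _≟_ y l) (here refl)
  ... | m , m∈ , m≤ with List.∈-∃++ m∈
  ... | ys , zs , eq = m , zs ++ ys , len , above , c′
    where
    c′ : Cyclic (m ∷ zs ++ ys)
    c′ = cyclic-rotate ys zs (subst Cyclic eq c)
    len : length l ≡ suc (length (zs ++ ys))
    len = trans (cong length eq) (trans (List.length-++ ys) (trans (ℕ.+-comm (length ys) _)
      (cong suc (sym (List.length-++ zs)))))
    above : All (m <_) (zs ++ ys)
    above with (m∉ ∷ _) , _ ← c′ = All.tabulate λ {y} y∈ → Fin.≤∧≢⇒<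
      (m≤ y (subst (y List.∈_) (sym eq) (case List.∈-++⁻ zs y∈ of λ where
        (inj₁ p) → List.∈-++⁺ʳ ys (there p)
        (inj₂ p) → List.∈-++⁺ˡ p)))
      (All.lookup m∉ y∈)

module _ {G : Graph N} {t : Tiering N} where

  -- The two neighbours on a cycle of its smallest vertex would be joined above that vertex.
  acyclic : IsZeroMaxmin G t → Acyclic G
  acyclic Z cyc with cycle⇒cyclic cyc
  ... | l , 3≤ , c with least-first l c
  ... | m , [] , len , _ , _ with s≤s () ← subst (3 ℕ.≤_) len 3≤
  ... | m , _ ∷ [] , len , _ , _ with s≤s (s≤s ()) ← subst (3 ℕ.≤_) len 3≤
  ... | m , p ∷ x ∷ xs , _ , p> ∷ x> , (_ ∷ p∉ ∷ _) , cons m~p ch , e =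
    contradiction p≡q (All.lookup p∉ q∈)
    where
    open IsZeroMaxmin Z
    q∈ : end x xs List.∈ x ∷ xs
    q∈ = end-∈ x xs
    p≡q : p ≡ end x xs
    p≡q = neighbour-unique m~p (symmetric e) p> (All.lookup x> q∈)
      (chain⇒walk p (x ∷ xs) (p> ∷ x>) ch)

  zeroMaxmin⇒maxmin : IsZeroMaxmin G t → (∃ λ v → t v ≡ true) × (∃ λ v → t v ≡ false) → IsMaxmin G t
  zeroMaxmin⇒maxmin Z surj = record
    { tree = (λ u v → T-ext symmetric symmetric) ,
             (λ u → T-ext irreflexive λ ()) ,
             (λ u v → star⇒walk (connected u v)) ,
             acyclic Z
    ; surjective = surj
    ; alternate  = alternate
    ; monotone   = λ v v′ e v′<v → ⇐ T-∧ (increasing (symmetric e) v′<v)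
    }
    where
    open IsZeroMaxmin Z
    alternate : ∀ v v′ → T (G v v′) → t v ≢ t v′
    alternate v v′ e eq with ℕ.<-cmp (toℕ v) (toℕ v′)
    ... | tri< v<v′ _ _ = let p , q = increasing e v<v′ in T-not q (subst T (sym eq) p)
    ... | tri≈ _ v≡v′ _ = irreflexive (subst (T ∘ G v) (sym (Fin.toℕ-injective v≡v′)) e)
    ... | tri> _ _ v′<v = let p , q = increasing (symmetric e) v′<v in T-not q (subst T eq p)

  maxmin⇒zeroMaxmin : IsMaxmin G t → weight G t ≡ 0 → IsZeroMaxmin G t
  maxmin⇒zeroMaxmin M w≡0 = record
    { symmetric   = symmetric
    ; irreflexive = λ {x} e → alternate x x e refl
    ; increasing  = increasing
    ; inner       = λ {v} nt → inner nt (connected v (proj₁ (proj₁ surjective)))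
    ; connected   = connected
    ; zeroWeight  = weight≡0⇒zeroWeight G t symmetric increasing connected w≡0
    }
    where
    open IsMaxmin M
    symmetric : ∀ {x y} → T (G x y) → T (G y x)
    symmetric {x} {y} = subst T (proj₁ tree x y)
    increasing : ∀ {v u} → T (G v u) → v < u → T (t u) × T (not (t v))
    increasing {v} {u} e v<u = ⇒ T-∧ (monotone u v (symmetric e) v<u)
    connected : ∀ x y → Star (Above G 0) x y
    connected x y = walk⇒star (proj₁ (proj₂ (proj₂ tree)) x y)
    -- The walk leads to a maximum. Its first edge cannot go to a smaller label, since that would
    -- make `v` a maximum.
    inner : ∀ {v} → T (not (t v)) → Star (Above G 0) v (proj₁ (proj₁ surjective)) →
            ∃ λ u → v < u × T (G v u)
    inner nt ε = contradiction (⇐ T-≡ (proj₂ (proj₁ surjective))) (T-not nt)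
    inner {v} nt (_◅_ {j = u} (e , _) _) with ℕ.<-cmp (toℕ v) (toℕ u)
    ... | tri< v<u _ _ = u , v<u , e
    ... | tri≈ _ v≡u _ = contradiction (cong t (Fin.toℕ-injective v≡u)) (alternate v u e)
    ... | tri> _ _ u<v = contradiction (proj₁ (increasing (symmetric e) u<v)) (T-not nt)

-- The index `suc n` provides the vertex `suc zero`, a proper descendant of the root, so the root is
-- a minimum.
leafTier-surjective : ∀ {n} (O : TreeOrder (suc n)) → let open TreeOrder O in
  (∃ λ v → leafTier v ≡ true) × (∃ λ v → leafTier v ≡ false)
leafTier-surjective O = let y , _ , ly = leaf-above zero in
  (y , ⇒ T-≡ (does-T (leaf? y) ly)) ,
  (zero , T-ext (λ p → contradiction (T-does (leaf? zero) p (suc zero) ⊑-root) λ ()) (λ ()))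
  where open TreeOrder O

-- Permutations and increasing trees

module _ {n} (π : Permutation′ n) where
  private
    ρ = lift₀ π
    pos : Fin (suc n) → Fin (suc n)
    pos = ρ ⟨$⟩ˡ_
    val : Fin (suc n) → Fin (suc n)
    val = ρ ⟨$⟩ʳ_

    pos-injective : ∀ {x y} → toℕ (pos x) ≡ toℕ (pos y) → x ≡ y
    pos-injective {x} {y} eq =
      trans (sym (inverseʳ ρ)) (trans (cong val (Fin.toℕ-injective eq)) (inverseʳ ρ))

  -- lift₀ π is the word 0 π(1) ⋯ π(n).
  wordOrder : TreeOrder n
  wordOrder = record
    { _⊑_     = _⊑_
    ; _⊑?_    = λ a b → (pos a ≤? pos b) ×-dec
                  Fin.all? (λ z → (pos a ≤? pos z) →-dec ((pos z ≤? pos b) →-dec (a ≤? z)))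
    ; ⊑-refl  = λ {a} → ℕ.≤-refl , λ z p q → Fin.≤-reflexive (pos-injective (ℕ.≤-antisym p q))
    ; ⊑⇒≤     = λ {a} {b} (p , h) → h b p ℕ.≤-refl
    ; ⊑-trans = ⊑-trans
    ; ⊑-chain = ⊑-chain
    ; ⊑-root  = z≤n , λ _ _ _ → z≤n
    }
    where
    _⊑_ : Fin (suc n) → Fin (suc n) → Set
    a ⊑ b = pos a ≤ pos b × (∀ z → pos a ≤ pos z → pos z ≤ pos b → a ≤ z)

    ⊑-trans : ∀ {a b c} → a ⊑ b → b ⊑ c → a ⊑ c
    ⊑-trans {a} {b} {c} (ab , f) (bc , g) = ℕ.≤-trans ab bc , λ z p q →
      [ f z p , (λ r → ℕ.≤-trans (f b ab ℕ.≤-refl) (g z r q)) ]′ (Fin.≤-total (pos z) (pos b))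

    -- If `b` precedes `a`, then `a` lies between `b` and `c`, so `b ≤ a` and the two coincide.
    ⊑-chain : ∀ {a b c} → a ⊑ c → b ⊑ c → a ≤ b → a ⊑ b
    ⊑-chain {a} {b} {c} (ac , f) (bc , g) a≤b with Fin.≤-total (pos a) (pos b)
    ... | inj₁ ab = ab , λ z p q → f z p (ℕ.≤-trans q bc)
    ... | inj₂ ba with Fin.≤-antisym a≤b (g a ba ac)
    ... | refl = ℕ.≤-refl , λ z p q → f z p (ℕ.≤-trans q bc)

  open TreeOrder wordOrder

  wordOrder-leaf-last : Leaf (val (fromℕ n))
  wordOrder-leaf-last y (p , _) = Fin.≤-reflexive (sym (pos-injective (ℕ.≤-antisym p
    (subst (toℕ (pos y) ℕ.≤_) (sym (trans (cong toℕ (inverseˡ ρ)) (Fin.toℕ-fromℕ n)))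
      (ℕ.s≤s⁻¹ (Fin.toℕ<n (pos y)))))))

  -- No letter lies strictly between the neighbours `a` and `b`, so `a ≤ b` makes `b` a descendant
  -- of `a`; and if `b < a`, then `b` blocks all later letters from being descendants of `a`.
  wordOrder-leaf : ∀ p → Leaf (val (inject₁ p)) ⇔ val (suc p) < val (inject₁ p)
  wordOrder-leaf p = mk⇔ to from
    where
    a = val (inject₁ p)
    b = val (suc p)
    pos-a : toℕ (pos a) ≡ toℕ p
    pos-a = trans (cong toℕ (inverseˡ ρ)) (Fin.toℕ-inject₁ p)
    pos-b : toℕ (pos b) ≡ suc (toℕ p)
    pos-b = cong toℕ (inverseˡ ρ)

    to : Leaf a → b < a
    to l = ℕ.≰⇒> λ a≤b → case Fin.≤-antisym a≤b (l b (pa≤pb , between a≤b)) of λ a≡b →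
        ℕ.1+n≢n (trans (sym pos-b) (trans (cong (toℕ ∘ pos) (sym a≡b)) pos-a))
      where
      pa≤pb : pos a ≤ pos b
      pa≤pb = subst₂ ℕ._≤_ (sym pos-a) (sym pos-b) (ℕ.n≤1+n _)
      between : a ≤ b → ∀ z → pos a ≤ pos z → pos z ≤ pos b → a ≤ z
      between a≤b z az zb with ℕ.m≤n⇒m<n∨m≡n az
      ... | inj₂ eq = Fin.≤-reflexive (pos-injective eq)
      ... | inj₁ lt = subst (a ≤_) (pos-injective (ℕ.≤-antisym
              (subst (ℕ._≤ toℕ (pos z)) (sym pos-b) (subst (ℕ._< toℕ (pos z)) pos-a lt)) zb)) a≤b

    from : b < a → Leaf a
    from b<a y (ay , h) with ℕ.m≤n⇒m<n∨m≡n ay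
    ... | inj₂ eq = Fin.≤-reflexive (sym (pos-injective eq))
    ... | inj₁ lt = contradiction
      (h b (subst₂ ℕ._≤_ (sym pos-a) (sym pos-b) (ℕ.n≤1+n _))
           (subst (ℕ._≤ toℕ (pos y)) (sym pos-b) (subst (ℕ._< toℕ (pos y)) pos-a lt)))
      (ℕ.<⇒≱ b<a)

-- Counting leaves by descents.

𝟙 : Dec A → ℕ
𝟙 a? = Bool.if does a? then 1 else 0

𝟙-⇔ : ∀ {B : Set} → A ⇔ B → (a? : Dec A) (b? : Dec B) → 𝟙 a? ≡ 𝟙 b?
𝟙-⇔ A⇔B a? b? = cong (Bool.if_then 1 else 0) (does-⇔ A⇔B a? b?)

length-filter : ∀ {P : A → Set} (P? : ∀ x → Dec (P x)) {n} (f : Fin n → A) →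
                length (filter P? (List.tabulate f)) ≡ ∑.sum (λ i → 𝟙 (P? (f i)))
length-filter P? {zero}  f = refl
length-filter P? {suc n} f with does (P? (f zero))
... | true  = cong suc (length-filter P? (f ∘ suc))
... | false = length-filter P? (f ∘ suc)

-- The leading letter `0` starts no descent: the summand at `zero` computes to `0`, and the others
-- are those of `π`.
descents-sum : ∀ {n} (π : Permutation′ n) →
  ∑.sum (λ p → 𝟙 ((lift₀ π ⟨$⟩ʳ suc p) <? (lift₀ π ⟨$⟩ʳ inject₁ p))) ≡ descents π
descents-sum {zero}  π = refl
descents-sum {suc m} π = sym (length-filter (λ i → (π ⟨$⟩ʳ suc i) <? (π ⟨$⟩ʳ inject₁ i)) id)

-- Sum over positions instead of labels: all positions but the last contribute descents, and the
-- last letter, always a leaf, contributes the extra `1`.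
leaves-wordOrder : ∀ {n} (π : Permutation′ n) → let open TreeOrder (wordOrder π) in
  length (filter (λ v → leafTier v Bool.≟ true) (allFin (suc n))) ≡ suc (descents π)
leaves-wordOrder {n} π = begin
  length (filter (λ v → leafTier v Bool.≟ true) (allFin (suc n)))
    ≡⟨ length-filter (λ v → leafTier v Bool.≟ true) id ⟩
  ∑.sum (λ v → 𝟙 (leafTier v Bool.≟ true))
    ≡⟨ ∑.sum-cong-≗ (λ v → 𝟙-⇔ (mk⇔ (T-does (leaf? v) ∘ ⇐ T-≡) (⇒ T-≡ ∘ does-T (leaf? v)))
                             (leafTier v Bool.≟ true) (leaf? v)) ⟩
  ∑.sum (λ v → 𝟙 (leaf? v))
    ≡⟨ ∑.sum-permute (λ v → 𝟙 (leaf? v)) (lift₀ π) ⟩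
  ∑.sum (λ p → 𝟙 (leaf? (lift₀ π ⟨$⟩ʳ p)))
    ≡⟨ ∑.sum-init-last (λ p → 𝟙 (leaf? (lift₀ π ⟨$⟩ʳ p))) ⟩
  ∑.sum (λ p → 𝟙 (leaf? (lift₀ π ⟨$⟩ʳ inject₁ p))) + 𝟙 (leaf? (lift₀ π ⟨$⟩ʳ fromℕ n))
    ≡⟨ cong₂ _+_
         (∑.sum-cong-≗ (λ p → 𝟙-⇔ (wordOrder-leaf π p) (leaf? _) (_ <? _)))
         (𝟙-⇔ (mk⇔ (λ _ → tt) (λ _ → wordOrder-leaf-last π)) (leaf? _) (yes tt)) ⟩
  ∑.sum (λ p → 𝟙 ((lift₀ π ⟨$⟩ʳ suc p) <? (lift₀ π ⟨$⟩ʳ inject₁ p))) + 1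
    ≡⟨ cong (_+ 1) (descents-sum π) ⟩
  descents π + 1
    ≡⟨ ℕ.+-comm (descents π) 1 ⟩
  suc (descents π) ∎
  where
  open TreeOrder (wordOrder π)
  open ≡-Reasoning

-- The lexicographic order on the characteristic vectors of the ancestor sets.
module AncestorLex {n} (O : TreeOrder n) where
  open TreeOrder O

  infix 4 _≺_
  _≺_ : Fin (suc n) → Fin (suc n) → Set
  x ≺ y = ∃ λ b → b ⊑ y × ¬ b ⊑ x × (∀ d → d < b → d ⊑ x ⇔ d ⊑ y)

  ≺-irrefl : ∀ {x} → ¬ x ≺ x
  ≺-irrefl (_ , p , q , _) = q p

  ≺-trans : ∀ {x y z} → x ≺ y → y ≺ z → x ≺ z
  ≺-trans (b , b⊑y , b⋢x , f) (c , c⊑z , c⋢y , g) with ℕ.<-cmp (toℕ b) (toℕ c)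
  ... | tri< b<c _ _ = b , ⇒ (g b b<c) b⊑y , b⋢x ,
        λ d d<b → let h = g d (ℕ.<-trans d<b b<c) in
          mk⇔ (⇒ h ∘ ⇒ (f d d<b)) (⇐ (f d d<b) ∘ ⇐ h)
  ... | tri≈ _ b≡c _ = contradiction (subst (_⊑ _) (Fin.toℕ-injective b≡c) b⊑y) c⋢y
  ... | tri> _ _ c<b = c , c⊑z , c⋢y ∘ ⇒ (f c c<b) ,
        λ d d<c → let h = f d (ℕ.<-trans d<c c<b) in
          mk⇔ (⇒ (g d d<c) ∘ ⇒ h) (⇐ h ∘ ⇐ (g d d<c))

  ≺-total : ∀ {x y} → x ≢ y → x ≺ y ⊎ y ≺ x
  ≺-total {x} {y} x≢y = first (least differ? (proj₂ differing))
    where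
    Differ : Fin (suc n) → Set
    Differ b = (b ⊑ x × ¬ b ⊑ y) ⊎ (b ⊑ y × ¬ b ⊑ x)
    differ? : ∀ b → Dec (Differ b)
    differ? b = ((b ⊑? x) ×-dec ¬? (b ⊑? y)) ⊎-dec ((b ⊑? y) ×-dec ¬? (b ⊑? x))
    differing : ∃ Differ
    differing with x ⊑? y | y ⊑? x
    ... | no x⋢y  | _       = x , inj₁ (⊑-refl , x⋢y)
    ... | yes _   | no y⋢x  = y , inj₂ (⊑-refl , y⋢x)
    ... | yes x⊑y | yes y⊑x = contradiction (Fin.≤-antisym (⊑⇒≤ x⊑y) (⊑⇒≤ y⊑x)) x≢y
    agree : ∀ {b} → (∀ d → Differ d → b ≤ d) → ∀ d → d < b → d ⊑ x ⇔ d ⊑ y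
    agree b≤ d d<b with d ⊑? x | d ⊑? y
    ... | yes p | yes q = mk⇔ (λ _ → q) (λ _ → p)
    ... | yes p | no ¬q = contradiction (b≤ d (inj₁ (p , ¬q))) (ℕ.<⇒≱ d<b)
    ... | no ¬p | yes q = contradiction (b≤ d (inj₂ (q , ¬p))) (ℕ.<⇒≱ d<b)
    ... | no ¬p | no ¬q = mk⇔ (λ p → contradiction p ¬p) (λ q → contradiction q ¬q)
    first : ∃ (Least Differ) → x ≺ y ⊎ y ≺ x
    first (b , inj₁ (b⊑x , b⋢y) , b≤) = inj₂ (b , b⊑x , b⋢y , λ d d<b →
      mk⇔ (⇐ (agree b≤ d d<b)) (⇒ (agree b≤ d d<b)))
    first (b , inj₂ (b⊑y , b⋢x) , b≤) = inj₁ (b , b⊑y , b⋢x , agree b≤)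

  _≺?_ : ∀ x y → Dec (x ≺ y)
  x ≺? y with x ≟ y
  ... | yes refl = no ≺-irrefl
  ... | no x≢y with ≺-total x≢y
  ... | inj₁ x≺y = yes x≺y
  ... | inj₂ y≺x = no λ x≺y → ≺-irrefl (≺-trans x≺y y≺x)

  ⊑⇒⊀ : ∀ {a b} → a ⊑ b → ¬ b ≺ a
  ⊑⇒⊀ a⊑b (c , c⊑a , c⋢b , _) = c⋢b (⊑-trans c⊑a a⊑b)

  -- Below `a`, the ancestors of `b` are those of `a`. If `z < a` and `a ≺ z`, the label separating
  -- them is at most `z`, hence below `a`, so it also separates `b` from `z` and gives `b ≺ z`.
  ⊑⇒between : ∀ {a b} → a ⊑ b → ∀ z → ¬ z ≺ a → ¬ b ≺ z → a ≤ z
  ⊑⇒between {a} {b} a⊑b z z⊀a b⊀z = ℕ.≮⇒≥ λ z<a →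
    case ≺-total (Fin.<⇒≢ z<a) of λ where
      (inj₁ z≺a) → z⊀a z≺a
      (inj₂ (c , c⊑z , c⋢a , f)) → let c<a = ℕ.≤-<-trans (⊑⇒≤ c⊑z) z<a in
        b⊀z (c , c⊑z , (λ c⊑b → c⋢a (⊑-chain c⊑b a⊑b (ℕ.<⇒≤ c<a))) ,
          λ d d<c → mk⇔
            (λ d⊑b → ⇒ (f d d<c) (⊑-chain d⊑b a⊑b (ℕ.<⇒≤ (ℕ.<-trans d<c c<a))))
            (λ d⊑z → ⊑-trans (⇐ (f d d<c) d⊑z) a⊑b))

  -- Let `c` separate `a ≺ b`. Then `c < a`, since `a < c` would give `a ⊑ b` and `a` equal to `c`
  -- would give `c ⊑ a`. But `c` lies between `a` and `b` in the order, against the hypothesis.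
  between⇒⊑ : ∀ {a b} → ¬ b ≺ a → (∀ z → ¬ z ≺ a → ¬ b ≺ z → a ≤ z) → a ⊑ b
  between⇒⊑ {a} {b} b⊀a h with a ⊑? b
  ... | yes a⊑b = a⊑b
  ... | no a⋢b with ≺-total {a} {b} (λ { refl → a⋢b ⊑-refl })
  ... | inj₂ b≺a = contradiction b≺a b⊀a
  ... | inj₁ (c , c⊑b , c⋢a , f) with ℕ.<-cmp (toℕ a) (toℕ c)
  ... | tri< a<c _ _ = contradiction (⇒ (f a a<c) ⊑-refl) a⋢b
  ... | tri≈ _ a≡c _ = contradiction (subst (_⊑ a) (Fin.toℕ-injective a≡c) ⊑-refl) c⋢a
  ... | tri> _ _ c<a = contradiction (h c c⊀a (⊑⇒⊀ c⊑b)) (ℕ.<⇒≱ c<a)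
    where
    c⊀a : ¬ c ≺ a
    c⊀a (e , e⊑a , e⋢c , g) with ℕ.<-cmp (toℕ e) (toℕ c)
    ... | tri< e<c _ _ = e⋢c (⊑-chain (⇒ (f e e<c) e⊑a) c⊑b (ℕ.<⇒≤ e<c))
    ... | tri≈ _ e≡c _ = c⋢a (subst (_⊑ a) (Fin.toℕ-injective e≡c) e⊑a)
    ... | tri> _ _ c<e = c⋢a (⇒ (g c c<e) ⊑-refl)

-- The separating label `b` is the smallest letter after `x` and up to `y`. A smaller label does not
-- occur in that stretch, so it is an ancestor of both `x` and `y` or of neither.
word-lex : ∀ {n} (π : Permutation′ n) {x y} → (lift₀ π ⟨$⟩ˡ x) < (lift₀ π ⟨$⟩ˡ y) →
           AncestorLex._≺_ (wordOrder π) x y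
word-lex {n} π {x} {y} x<y
  with least (λ z → (pos x <? pos z) ×-dec (pos z ≤? pos y)) (x<y , ℕ.≤-refl)
  where
  pos : Fin (suc n) → Fin (suc n)
  pos = lift₀ π ⟨$⟩ˡ_
... | b , (xb , by) , b≤ = b ,
  (by , λ z bz zy → b≤ z (ℕ.<-≤-trans xb bz , zy)) ,
  (λ (bx , _) → ℕ.<⇒≱ xb bx) ,
  λ d d<b → mk⇔
    (λ (dx , h) → ℕ.≤-trans dx (ℕ.<⇒≤ x<y) , λ z dz zy → case pos z ≤? pos x of λ where
      (yes zx) → h z dz zx
      (no z≰x) → ℕ.≤-trans (ℕ.<⇒≤ d<b) (b≤ z (ℕ.≰⇒> z≰x , zy)))
    (λ (dy , h) → case pos d ≤? pos x of λ where
      (yes dx) → dx , λ z dz zx → h z dz (ℕ.≤-trans zx (ℕ.<⇒≤ x<y))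
      (no d≰x) → contradiction (b≤ d (ℕ.≰⇒> d≰x , dy)) (ℕ.<⇒≱ d<b))
  where
  pos : Fin (suc n) → Fin (suc n)
  pos = lift₀ π ⟨$⟩ˡ_

-- Correspondence between words and ancestor relations.

strictMono⇒inflationary : ∀ {f : Fin N → Fin N} → (∀ {i j} → i < j → f i < f j) → ∀ i → i ≤ f i
strictMono⇒inflationary {f = f} mono i = go i (Fin.<-wellFounded i)
  where
  go : ∀ i → Acc _<_ i → i ≤ f i
  go i (acc rec) = ℕ.≮⇒≥ λ fi<i → ℕ.<⇒≱ (mono fi<i) (go (f i) (rec fi<i))

-- Sending the position of a letter in one word to its position in the other is strictly increasing,
-- hence inflationary. The same holds in the other direction, so the positions agree.
wordOrder-injective : ∀ {n} (π σ : Permutation′ n) →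
  wordOrder π ≅ wordOrder σ →
  ∀ i → π ⟨$⟩ʳ i ≡ σ ⟨$⟩ʳ i
wordOrder-injective {n} π σ h i = Fin.suc-injective (trans
    (sym (inverseʳ (lift₀ σ)))
    (cong (lift₀ σ ⟨$⟩ʳ_) (Fin.≤-antisym
      (subst (pos′ a ≤_) (inverseˡ (lift₀ π)) 
        (lower (λ {x} {y} → transfer σ π (λ {x} {y} → mk⇔ (⇐ h) (⇒ h)) {x} {y}) a))
      (subst (ℕ._≤ toℕ (pos′ a)) (cong toℕ (inverseˡ (lift₀ π)))
        (lower (λ {x} {y} → transfer π σ h {x} {y}) a)))))
  where
  a = lift₀ π ⟨$⟩ʳ suc i
  pos′ : Fin (suc n) → Fin (suc n)
  pos′ = lift₀ σ ⟨$⟩ˡ_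

  -- `word-lex` puts `x` before `y` in the common lexicographic order; the reverse order of
  -- positions in `σ` would give the opposite comparison.
  transfer : ∀ (π σ : Permutation′ n) →
    wordOrder π ≅ wordOrder σ →
    ∀ {x y} → (lift₀ π ⟨$⟩ˡ x) < (lift₀ π ⟨$⟩ˡ y) → (lift₀ σ ⟨$⟩ˡ x) < (lift₀ σ ⟨$⟩ˡ y)
  transfer π σ h {x} {y} x<y with word-lex π x<y
  ... | b , by , bx , f = ℕ.≰⇒> λ yx → case ℕ.m≤n⇒m<n∨m≡n yx of λ {
    (inj₂ eq) → ℕ.<-irrefl (cong (toℕ ∘ (lift₀ π ⟨$⟩ˡ_)) (x≡y eq)) x<y ;
    (inj₁ y<x) → ≺-irrefl (≺-trans {x} {y} {x}
      (b , ⇒ h by , bx ∘ ⇐ h , λ d d<b → mk⇔ (⇒ h ∘ ⇒ (f d d<b) ∘ ⇐ h) (⇒ h ∘ ⇐ (f d d<b) ∘ ⇐ h))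
      (word-lex σ y<x)) }
    where
    open AncestorLex (wordOrder σ)
    x≡y : toℕ (lift₀ σ ⟨$⟩ˡ y) ≡ toℕ (lift₀ σ ⟨$⟩ˡ x) → x ≡ y
    x≡y eq = trans (sym (inverseʳ (lift₀ σ)))
      (trans (cong (lift₀ σ ⟨$⟩ʳ_) (sym (Fin.toℕ-injective eq))) (inverseʳ (lift₀ σ)))

  lower : ∀ {π σ : Permutation′ n} →
    (∀ {x y} → (lift₀ π ⟨$⟩ˡ x) < (lift₀ π ⟨$⟩ˡ y) → (lift₀ σ ⟨$⟩ˡ x) < (lift₀ σ ⟨$⟩ˡ y)) →
    ∀ x → (lift₀ π ⟨$⟩ˡ x) ≤ (lift₀ σ ⟨$⟩ˡ x)
  lower {π} {σ} mono x = subst (λ z → (lift₀ π ⟨$⟩ˡ x) ≤ (lift₀ σ ⟨$⟩ˡ z)) (inverseʳ (lift₀ π))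
    (strictMono⇒inflationary {f = λ i → lift₀ σ ⟨$⟩ˡ (lift₀ π ⟨$⟩ʳ i)}
      (λ i<j → mono (subst₂ _<_ (sym (inverseˡ (lift₀ π))) (sym (inverseˡ (lift₀ π))) i<j))
      (lift₀ π ⟨$⟩ˡ x))

injective⇒surjective : ∀ {f : Fin N → Fin N} → (∀ {x y} → f x ≡ f y → x ≡ y) → ∀ y → ∃ λ x → f x ≡ y
injective⇒surjective {N = suc N} {f} inj y with Fin.any? (λ x → f x ≟ y)
... | yes p = p
... | no ¬p = contradiction
  (Fin.injective⇒≤ {f = λ x → punchOut (y≢ x)} 
    (λ {x} {z} eq → inj (Fin.punchOut-injective (y≢ x) (y≢ z) eq)))
  ℕ.1+n≰n
  where
  y≢ : ∀ x → y ≢ f x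
  y≢ x y≡fx = ¬p (x , sym y≡fx)

module _ {_≺_ : Fin N → Fin N → Set} (_≺?_ : ∀ x y → Dec (x ≺ y)) (irrefl : ∀ {x} → ¬ x ≺ x)
         (≺-trans : ∀ {x y z} → x ≺ y → y ≺ z → x ≺ z)
         (total : ∀ {x y} → x ≢ y → x ≺ y ⊎ y ≺ x) where

  private
    before : Fin N → Subset N
    before x = tabulate λ y → does (y ≺? x)

    before⁺ : ∀ {x y} → y ≺ x → y ∈ before x
    before⁺ {x} {y} p = ∋⇒∈ (T-tabulate⁺ (λ y → does (y ≺? x)) y (does-T (y ≺? x) p))

    before⁻ : ∀ {x y} → y ∈ before x → y ≺ x
    before⁻ {x} {y} p = T-does (y ≺? x) (T-tabulate⁻ (λ y → does (y ≺? x)) y (∈⇒∋ p))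

    -- The number of predecessors, which is below `N` because `x` does not precede itself.
    rank : Fin N → Fin N
    rank x = fromℕ< (subst (∣ before x ∣ ℕ.<_) (Sub.∣⊤∣≡n N)
      (Sub.p⊂q⇒∣p∣<∣q∣ (Sub.⊆⊤ , x , Sub.∈⊤ , irrefl ∘ before⁻)))

    rank-mono : ∀ {x y} → x ≺ y → rank x < rank y
    rank-mono {x} {y} x≺y = subst₂ ℕ._<_ (sym (Fin.toℕ-fromℕ< _)) (sym (Fin.toℕ-fromℕ< _))
      (Sub.p⊂q⇒∣p∣<∣q∣
        ((λ z∈ → before⁺ (≺-trans (before⁻ z∈) x≺y)) , x , before⁺ x≺y , irrefl ∘ before⁻))

    rank-injective : ∀ {x y} → rank x ≡ rank y → x ≡ y
    rank-injective {x} {y} eq with x ≟ y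
    ... | yes x≡y = x≡y
    ... | no x≢y with total x≢y
    ... | inj₁ x≺y = contradiction eq (Fin.<⇒≢ (rank-mono x≺y))
    ... | inj₂ y≺x = contradiction (sym eq) (Fin.<⇒≢ (rank-mono y≺x))

    unrank : ∀ i → ∃ λ x → rank x ≡ i
    unrank = injective⇒surjective rank-injective

  sort : ∃ λ (π : Permutation′ N) → ∀ {x y} → x ≺ y → (π ⟨$⟩ˡ x) < (π ⟨$⟩ˡ y)
  sort = permutation (proj₁ ∘ unrank) rank
      (λ x → rank-injective (proj₂ (unrank (rank x)))) (proj₂ ∘ unrank) ,
    rank-mono

-- Once positions follow `≺`, the interval condition of the word order is that of `⊑⇒between` and
-- `between⇒⊑`. Only the nonzero labels have to be sorted, because the root is minimal for `≺`.
sorted⇒wordOrder : ∀ {n} (O : TreeOrder n) (π : Permutation′ n) →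
  (∀ {x y} → AncestorLex._≺_ O (suc x) (suc y) → (π ⟨$⟩ˡ x) < (π ⟨$⟩ˡ y)) →
  wordOrder π ≅ O
sorted⇒wordOrder {n} O π mono = mk⇔
    (λ (ab , h) → between⇒⊑ (≤⇒⊀ ab) λ z za bz → h z (⊀⇒≤ za) (⊀⇒≤ bz))
    (λ a⊑b → ⊀⇒≤ (⊑⇒⊀ a⊑b) , λ z az zb → ⊑⇒between a⊑b z (≤⇒⊀ az) (≤⇒⊀ zb))
  where
  open TreeOrder O
  open AncestorLex O

  pos : Fin (suc n) → Fin (suc n)
  pos = lift₀ π ⟨$⟩ˡ_

  ⊀-root : ∀ {x} → ¬ x ≺ zero
  ⊀-root (b , b⊑0 , b⋢x , _) = b⋢x (subst (_⊑ _) (Fin.≤-antisym z≤n (⊑⇒≤ b⊑0)) ⊑-root)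

  pos-mono : ∀ {x y} → x ≺ y → pos x < pos y
  pos-mono {_}     {zero}  p = contradiction p ⊀-root
  pos-mono {zero}  {suc y} p = s≤s z≤n
  pos-mono {suc x} {suc y} p = s≤s (mono p)

  ≤⇒⊀ : ∀ {x y} → pos x ≤ pos y → ¬ y ≺ x
  ≤⇒⊀ p q = ℕ.<⇒≱ (pos-mono q) p

  ⊀⇒≤ : ∀ {x y} → ¬ y ≺ x → pos x ≤ pos y
  ⊀⇒≤ {x} {y} y⊀x with x ≟ y
  ... | yes refl = ℕ.≤-refl
  ... | no x≢y with ≺-total x≢y
  ... | inj₁ x≺y = ℕ.<⇒≤ (pos-mono x≺y)
  ... | inj₂ y≺x = contradiction y≺x y⊀x

wordOrder-surjective : ∀ {n} (O : TreeOrder n) → ∃ λ π → wordOrder π ≅ O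
wordOrder-surjective O = π , sorted⇒wordOrder O π mono
  where
  open AncestorLex O
  sorted = sort {_≺_ = λ x y → suc x ≺ suc y} (λ x y → suc x ≺? suc y) ≺-irrefl ≺-trans
             (λ x≢y → ≺-total (x≢y ∘ Fin.suc-injective))
  π = proj₁ sorted
  mono = proj₂ sorted

-- Permutations are compared by their values, whereas the word order speaks of positions, that is,
-- of the inverses.
wordOrder-cong : ∀ {n} (π σ : Permutation′ n) → (∀ i → π ⟨$⟩ʳ i ≡ σ ⟨$⟩ʳ i) →
                 wordOrder π ≅ wordOrder σ
wordOrder-cong π σ π≈σ = mk⇔ (go π σ pos≡) (go σ π (sym ∘ pos≡))
  where
  pos≡ : ∀ x → lift₀ π ⟨$⟩ˡ x ≡ lift₀ σ ⟨$⟩ˡ x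
  pos≡ zero    = refl
  pos≡ (suc x) = cong suc (trans (sym (inverseˡ σ))
    (cong (σ ⟨$⟩ˡ_) (trans (sym (π≈σ (π ⟨$⟩ˡ x))) (inverseʳ π))))
  go : ∀ π σ → (∀ x → lift₀ π ⟨$⟩ˡ x ≡ lift₀ σ ⟨$⟩ˡ x) → ∀ {x y} →
       TreeOrder._⊑_ (wordOrder π) x y → TreeOrder._⊑_ (wordOrder σ) x y
  go π σ e {x} {y} (p , h) = subst₂ _≤_ (e x) (e y) p ,
    λ z xz zy → h z (subst₂ _≤_ (sym (e x)) (sym (e z)) xz) (subst₂ _≤_ (sym (e z)) (sym (e y)) zy)

-- Through `h`, the order `O` also describes walks in the graph of `O′`, and such an order
-- determines the graph.
treeGraph-cong : ∀ {n} (O O′ : TreeOrder n) → O ≅ O′ →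
  (∀ u v → TreeOrder.treeGraph O u v ≡ TreeOrder.treeGraph O′ u v) ×
  (∀ v → TreeOrder.leafTier O v ≡ TreeOrder.leafTier O′ v)
treeGraph-cong O O′ h = treeGraph≗ Z O spec , leafTier≗ Z O spec
  where
  Z = treeGraph-zeroMaxmin O′
  spec : ∀ {x y} → TreeOrder._⊑_ O x y ⇔ IsZeroMaxmin._⟶_ Z x y
  spec = mk⇔ (⇒ (treeGraph-spec O′) ∘ ⇒ h) (⇐ h ∘ ⇐ (treeGraph-spec O′))

treeGraph-injective : ∀ {n} (O O′ : TreeOrder n) →
  (∀ u v → TreeOrder.treeGraph O u v ≡ TreeOrder.treeGraph O′ u v) → O ≅ O′
treeGraph-injective O O′ eq = mk⇔
  (⇐ (treeGraph-spec O′) ∘ Star.map (λ {u} {v} (e , p) → subst T (eq u v) e , p)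
    ∘ ⇒ (treeGraph-spec O))
  (⇐ (treeGraph-spec O) ∘ Star.map (λ {u} {v} (e , p) → subst T (sym (eq u v)) e , p)
    ∘ ⇒ (treeGraph-spec O′))

-- The bijection.

wordTree : ∀ {n} → Permutation′ (suc n) → MaxminTree (suc (suc n))
wordTree π = record
  { graph  = TreeOrder.treeGraph (wordOrder π)
  ; tier   = TreeOrder.leafTier (wordOrder π)
  ; maxmin = zeroMaxmin⇒maxmin (treeGraph-zeroMaxmin (wordOrder π))
               (leafTier-surjective (wordOrder π))
  }

wordTree-surjective : ∀ {n} (M : MaxminTree (suc (suc n))) → let open MaxminTree M in
  weight graph tier ≡ 0 → ∃ λ (π : Permutation′ (suc n)) → let open TreeOrder (wordOrder π) in
    (∀ u v → treeGraph u v ≡ graph u v) × (∀ v → leafTier v ≡ tier v)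
wordTree-surjective M w≡0 =
  let π , π≅ = wordOrder-surjective (walkOrder Z)
  in π , treeGraph≗ Z (wordOrder π) π≅ , leafTier≗ Z (wordOrder π) π≅
  where Z = maxmin⇒zeroMaxmin (MaxminTree.maxmin M) w≡0

numTrue-cong : ∀ {t t′ : Tiering N} → (∀ v → t v ≡ t′ v) →
  length (filter (λ v → t v Bool.≟ true) (allFin N)) ≡
  length (filter (λ v → t′ v Bool.≟ true) (allFin N))
numTrue-cong {t = t} {t′} eq = trans (length-filter (λ v → t v Bool.≟ true) id)
  (trans (∑.sum-cong-≗ (λ v → cong (λ b → 𝟙 (b Bool.≟ true)) (eq v)))
         (sym (length-filter (λ v → t′ v Bool.≟ true) id)))

theorem4p1 : (n k : ℕ) → 1 ℕ.≤ n → k ℕ.≤ n ∸ 1 →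
    Bijection (PermsWithDescents n k) (Weight0MaxminTrees (suc n) (suc k))
theorem4p1 (suc n) k _ _ = record
  { to        = λ (π , d) → wordTree π ,
      zeroWeight⇒weightF≡0 _ _ (IsZeroMaxmin.zeroWeight (treeGraph-zeroMaxmin (wordOrder π)))
        (suc (suc n)) ⊤ ,
      trans (leaves-wordOrder π) (cong suc d)
  ; cong      = λ {(π , _)} {(σ , _)} → tree-cong π σ
  ; bijective =
      (λ {(π , _)} {(σ , _)} (eq , _) →
        wordOrder-injective π σ (treeGraph-injective (wordOrder π) (wordOrder σ) eq)) ,
      λ (M , w≡0 , maxima) → let π , graph≗ , tier≗ = wordTree-surjective M w≡0 in
        (π , ℕ.suc-injective
          (trans (sym (leaves-wordOrder π)) (trans (numTrue-cong tier≗) maxima))) ,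
        -- Surjectivity between setoids asks that every `σ` equivalent to the preimage `π` is sent
        -- to the given tree.
        λ {(σ , _)} σ≈π → let eqG , eqT = tree-cong σ π σ≈π in
          (λ u v → trans (eqG u v) (graph≗ u v)) , (λ v → trans (eqT v) (tier≗ v))
  }
  where
  tree-cong : ∀ (π σ : Permutation′ (suc n)) → (∀ i → π ⟨$⟩ʳ i ≡ σ ⟨$⟩ʳ i) →
    (∀ u v → TreeOrder.treeGraph (wordOrder π) u v ≡ TreeOrder.treeGraph (wordOrder σ) u v) ×
    (∀ v → TreeOrder.leafTier (wordOrder π) v ≡ TreeOrder.leafTier (wordOrder σ) v)
  tree-cong π σ π≈σ = treeGraph-cong (wordOrder π) (wordOrder σ) (wordOrder-cong π σ π≈σ)
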